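{- Let $k\geq 2$ be an integer. There does not exist a spherical latin bitrade whose canonical group is isomorphic to $\mathbb{Z}_2^k$.
   Context: Partial latin square: given finite, pairwise disjoint sets $R$ (rows), $C$ (columns), $S$ (symbols), a partial latin square is a subset $P\subseteq R\times C\times S$ such that any two distinct triples of $P$ agree in at most one coordinate; it is assumed that every element of $R$, $C$ and $S$ occurs in some triple of $P$. Latin bitrade: an ordered pair $(W,B)$ of non-empty partial latin squares (with common sets $R,C,S$) such that for each triple $(r,c,s)\in W$ (respectively $B$) there exist unique $r'\neq r$, $c'\neq c$, $s'\neq s$ with $\{(r',c,s),(r,c',s),(r,c,s')\}\subset B$ (respectively $W$). Its size is $|W|=|B|$. It is connected if there is no latin bitrade $(W',B')$ with $W'\subsetneq W$ and $B'\subsetneq B$. Separated: for each row $r$, define a permutation $\rho_r$ of the symbols in row $r$ by $\rho_r(s)=s'$ if and only if $(r,c,s)\in W$ and $(r,c,s')\in B$ for some $c\in C$; the row $r$ is separated if $\rho_r$ is a single cycle. Separated columns and symbols are defined analogously. The bitrade is separated if every row, column and symbol is separated. Spherical: from a connected separated latin bitrade $(W,B)$ construct a face two-coloured triangulation of a closed orientable surface with vertex set $R\sqcup C\sqcup S$, with an edge between two vertices if and only if they occur together in a triple of $W$ (equivalently of $B$), a white triangular face with vertices $r,c,s$ for each $(r,c,s)\in W$, and a black triangular face with vertices $r,c,s$ for each $(r,c,s)\in B$. A spherical latin bitrade is a connected separated latin bitrade for which this surface is the sphere (equivalently, a connected latin bitrade with $|R|+|C|+|S|=|W|+2$). Canonical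 group: for a partial latin square $P$ with sets $R,C,S$, let $\mathcal{A}_P$ be the abelian group with generating set $R\cup C\cup S$ subject to the relations $r+c+s=0$ for all $(r,c,s)\in P$. It is known that for a spherical latin bitrade $(W,B)$ one has $\mathcal{A}_W\cong\mathcal{A}_B\cong\mathbb{Z}\oplus\mathbb{Z}\oplus\mathcal{C}$ with $\mathcal{C}$ finite. The group $\mathcal{C}$ (the torsion subgroup of $\mathcal{A}_W$) is called the canonical group of $(W,B)$. $\mathbb{Z}_n$ denotes the cyclic group of order $n$. -}

module Defs where

open import Algebra.Bundles using (AbelianGroup)
import Algebra.Construct.Pointwise as Pointwise
open import Algebra.Morphism.Structures using (module GroupMorphisms)
import Algebra.Properties.AbelianGroup as AbelianGroupProperties
import Algebra.Properties.CommutativeMonoid.Mult as Mult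
open import Data.Bool.Base using (Bool; T)
open import Data.Bool.ListAction using (any)
open import Data.Fin.Base using (Fin)
open import Data.List.Base using (length; filterᵇ; allFin; cartesianProduct)
open import Data.Nat.Base as ℕ using (ℕ; zero; suc)
import Data.Nat.Properties as ℕₚ
open import Data.Parity.Properties using () renaming (+-0-abelianGroup to ℤ₂)
open import Data.Product using (Σ; Σ-syntax; ∃; ∃₂; ∃!; _×_; _,_; proj₁; proj₂)
open import Level using (Level; _⊔_; 0ℓ)
open import Relation.Binary.Construct.Closure.ReflexiveTransitive using (Star)
open import Relation.Binary.PropositionalEquality using (_≡_; _≢_)
open import Relation.Nullary using (¬_)
open import Relation.Unary using (_⊂_)

private
  variable
    c ℓ c′ ℓ′ : Level
    m n p : ℕ

-- R = Fin m, C = Fin n, S = Fin p.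
Triple : ℕ → ℕ → ℕ → Set
Triple m n p = Fin m × Fin n × Fin p

-- Subsets of R × C × S, given by their characteristic functions.
TripleSet : ℕ → ℕ → ℕ → Set
TripleSet m n p = Triple m n p → Bool

infix 4 _∈_ _⊊_

_∈_ : Triple m n p → TripleSet m n p → Set
t ∈ P = T (P t)

_⊊_ : TripleSet m n p → TripleSet m n p → Set
P ⊊ Q = (_∈ P) ⊂ (_∈ Q)

-- The requirement that every row, column and symbol be used is kept
-- separate, in Spanning: a smaller bitrade (see Connected) has for its
-- row, column and symbol sets just those elements that occur in it.
IsPartialLatinSquare : TripleSet m n p → Set
IsPartialLatinSquare P = ∀ {r c s r′ c′ s′} →
  (r , c , s) ∈ P → (r′ , c′ , s′) ∈ P → (r , c , s) ≢ (r′ , c′ , s′) →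
  ¬ (r ≡ r′ × c ≡ c′) × ¬ (r ≡ r′ × s ≡ s′) × ¬ (c ≡ c′ × s ≡ s′)

Spanning : TripleSet m n p → Set
Spanning {m} {n} {p} P =
  (∀ (r : Fin m) → ∃₂ λ c s → (r , c , s) ∈ P) ×
  (∀ (c : Fin n) → ∃₂ λ r s → (r , c , s) ∈ P) ×
  (∀ (s : Fin p) → ∃₂ λ r c → (r , c , s) ∈ P)

HasUniqueMates : TripleSet m n p → TripleSet m n p → Set
HasUniqueMates P Q = ∀ {r c s} → (r , c , s) ∈ P →
  (∃! _≡_ λ r′ → r′ ≢ r × (r′ , c , s) ∈ Q) ×
  (∃! _≡_ λ c′ → c′ ≢ c × (r , c′ , s) ∈ Q) ×
  (∃! _≡_ λ s′ → s′ ≢ s × (r , c , s′) ∈ Q)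

-- By the mate conditions, W and B use the same rows, columns and symbols.
record IsLatinBitrade (W B : TripleSet m n p) : Set where
  field
    W-nonEmpty : ∃ λ t → t ∈ W
    B-nonEmpty : ∃ λ t → t ∈ B
    W-partialLatinSquare : IsPartialLatinSquare W
    B-partialLatinSquare : IsPartialLatinSquare B
    W-mates : HasUniqueMates W B
    B-mates : HasUniqueMates B W

Connected : TripleSet m n p → TripleSet m n p → Set
Connected {m} {n} {p} W B =
  ¬ (Σ[ W′ ∈ TripleSet m n p ] Σ[ B′ ∈ TripleSet m n p ]
       IsLatinBitrade W′ B′ × W′ ⊊ W × B′ ⊊ B)

-- For a fixed row, w and b are the sets of (column, symbol) pairs that
-- complete it to a triple of W, respectively B.  The permutation ρ of the
-- symbols in that row is taken as its graph y ↦ y′; on a finite set it is a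
-- single cycle exactly when any symbol is reached from any other by
-- iterating ρ.
SingleCycle : {X Y : Set} (w b : X → Y → Set) → Set
SingleCycle {X} {Y} w b =
  ∀ {y y′} → Occurs y → Occurs y′ → Star ρ y y′
  where
  Occurs : Y → Set
  Occurs y = ∃ λ x → w x y

  ρ : Y → Y → Set
  ρ y y′ = ∃ λ x → w x y × b x y′

-- Columns and symbols are treated like rows by cyclically rotating the
-- coordinates.
record Separated (W B : TripleSet m n p) : Set where
  field
    rows    : ∀ r → SingleCycle (λ c s → (r , c , s) ∈ W) (λ c s → (r , c , s) ∈ B)
    columns : ∀ c → SingleCycle (λ s r → (r , c , s) ∈ W) (λ s r → (r , c , s) ∈ B)
    symbols : ∀ s → SingleCycle (λ r c → (r , c , s) ∈ W) (λ r c → (r , c , s) ∈ B)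

-- The rows, columns and symbols form a disjoint union.
data Vertex (m n p : ℕ) : Set where
  row    : Fin m → Vertex m n p
  column : Fin n → Vertex m n p
  symbol : Fin p → Vertex m n p

#triples : TripleSet m n p → ℕ
#triples {m} {n} {p} P =
  length (filterᵇ P (cartesianProduct (allFin m) (cartesianProduct (allFin n) (allFin p))))

#vertices : TripleSet m n p → TripleSet m n p → ℕ
#vertices {m} {n} {p} W B = m ℕ.+ n ℕ.+ p

-- An edge is a pair of vertices, of different kinds, that occur together in
-- a triple of W; in a bitrade these are also the pairs occurring in B.
#edges : TripleSet m n p → TripleSet m n p → ℕ
#edges {m} {n} {p} W B =
    length (filterᵇ (λ (r , c) → any (λ s → W (r , c , s)) (allFin p))
                    (cartesianProduct (allFin m) (allFin n)))
  ℕ.+ length (filterᵇ (λ (r , s) → any (λ c → W (r , c , s)) (allFin n))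
                    (cartesianProduct (allFin m) (allFin p)))
  ℕ.+ length (filterᵇ (λ (c , s) → any (λ r → W (r , c , s)) (allFin m))
                    (cartesianProduct (allFin n) (allFin p)))

#faces : TripleSet m n p → TripleSet m n p → ℕ
#faces W B = #triples W ℕ.+ #triples B

-- The surface of a connected separated bitrade is closed, connected and
-- orientable, so it is the sphere exactly when its Euler characteristic
-- V − E + F is 2.
record IsSpherical (W B : TripleSet m n p) : Set where
  field
    isLatinBitrade : IsLatinBitrade W B
    W-spanning     : Spanning W
    B-spanning     : Spanning B
    connected      : Connected W B
    separated      : Separated W B
    euler          : #vertices W B ℕ.+ #faces W B ≡ #edges W B ℕ.+ 2

record SphericalLatinBitrade : Set where
  field
    {#rows #columns #symbols} : ℕ
    W B         : TripleSet #rows #columns #symbols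
    isSpherical : IsSpherical W B

infix 4 _≅_

_≅_ : AbelianGroup c ℓ → AbelianGroup c′ ℓ′ → Set (c ⊔ ℓ ⊔ c′ ⊔ ℓ′)
G ≅ H = ∃ IsGroupIsomorphism
  where open GroupMorphisms (AbelianGroup.rawGroup G) (AbelianGroup.rawGroup H)

module Presentation {X I : Set} where

  infixl 6 _+_
  infix  8 -_

  data Term : Set where
    gen : X → Term
    0#  : Term
    _+_ : Term → Term → Term
    -_  : Term → Term

  module _ (rel : I → Term) where

    infix 4 _≈_

    data _≈_ : Term → Term → Set where
      relation  : ∀ i → rel i ≈ 0#
      refl      : ∀ {x} → x ≈ x
      sym       : ∀ {x y} → x ≈ y → y ≈ x
      trans     : ∀ {x y z} → x ≈ y → y ≈ z → x ≈ z
      +-cong    : ∀ {x x′ y y′} → x ≈ x′ → y ≈ y′ → x + y ≈ x′ + y′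
      -‿cong    : ∀ {x y} → x ≈ y → - x ≈ - y
      +-assoc   : ∀ x y z → (x + y) + z ≈ x + (y + z)
      +-comm    : ∀ x y → x + y ≈ y + x
      identityˡ : ∀ x → 0# + x ≈ x
      inverseˡ  : ∀ x → - x + x ≈ 0#

    presentedGroup : AbelianGroup 0ℓ 0ℓ
    presentedGroup = record
      { Carrier = Term
      ; _≈_     = _≈_
      ; _∙_     = _+_
      ; ε       = 0#
      ; _⁻¹     = -_
      ; isAbelianGroup = record
        { isGroup = record
          { isMonoid = record
            { isSemigroup = record
              { isMagma = record
                { isEquivalence = record { refl = refl ; sym = sym ; trans = trans }
                ; ∙-cong        = +-cong
                }
              ; assoc = +-assoc
              }
            ; identity = identityˡ , λ x → trans (+-comm x 0#) (identityˡ x)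
            }
          ; inverse = inverseˡ , λ x → trans (+-comm x (- x)) (inverseˡ x)
          ; ⁻¹-cong = -‿cong
          }
        ; comm = +-comm
        }
      }

module _ (G : AbelianGroup c ℓ) where

  open AbelianGroup G
  open AbelianGroupProperties G using (⁻¹-∙-comm; ε⁻¹≈ε)
  open Mult commutativeMonoid using (×-homo-1; ×-distrib-+; ×-assocˡ; ×-congʳ; ×-congˡ)
    renaming (_×_ to _·_)

  IsTorsion : Carrier → Set ℓ
  IsTorsion x = ∃ λ k → suc k · x ≈ ε

  private
    ·-zeroʳ : ∀ k → k · ε ≈ ε
    ·-zeroʳ zero    = refl
    ·-zeroʳ (suc k) = trans (identityˡ _) (·-zeroʳ k)

    ·-⁻¹ : ∀ k x → k · (x ⁻¹) ≈ (k · x) ⁻¹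
    ·-⁻¹ zero    x = sym ε⁻¹≈ε
    ·-⁻¹ (suc k) x = trans (∙-congˡ (·-⁻¹ k x)) (⁻¹-∙-comm x (k · x))

    torsion-ε : IsTorsion ε
    torsion-ε = 0 , ·-zeroʳ 1

    torsion-⁻¹ : ∀ {x} → IsTorsion x → IsTorsion (x ⁻¹)
    torsion-⁻¹ {x} (k , kx≈ε) =
      k , trans (·-⁻¹ (suc k) x) (trans (⁻¹-cong kx≈ε) ε⁻¹≈ε)

    torsion-∙ : ∀ {x y} → IsTorsion x → IsTorsion y → IsTorsion (x ∙ y)
    torsion-∙ {x} {y} (j , jx≈ε) (k , ky≈ε) =
      k ℕ.+ j ℕ.* suc k ,
      trans (×-distrib-+ x y (suc j ℕ.* suc k))
        (trans (∙-cong
          (trans (×-congˡ (ℕₚ.*-comm (suc j) (suc k)))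
            (trans (sym (×-assocˡ x (suc k) (suc j)))
              (trans (×-congʳ (suc k) jx≈ε) (·-zeroʳ (suc k)))))
          (trans (sym (×-assocˡ y (suc j) (suc k)))
            (trans (×-congʳ (suc j) ky≈ε) (·-zeroʳ (suc j)))))
          (identityˡ ε))

  torsionSubgroup : AbelianGroup (c ⊔ ℓ) ℓ
  torsionSubgroup = record
    { Carrier = Σ Carrier IsTorsion
    ; _≈_     = λ x y → proj₁ x ≈ proj₁ y
    ; _∙_     = λ (x , tx) (y , ty) → x ∙ y , torsion-∙ tx ty
    ; ε       = ε , torsion-ε
    ; _⁻¹     = λ (x , tx) → x ⁻¹ , torsion-⁻¹ tx
    ; isAbelianGroup = record
      { isGroup = record
        { isMonoid = record
          { isSemigroup = record
            { isMagma = record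
              { isEquivalence = record
                { refl = refl ; sym = sym ; trans = trans }
              ; ∙-cong = ∙-cong
              }
            ; assoc = λ x y z → assoc (proj₁ x) (proj₁ y) (proj₁ z)
            }
          ; identity = (λ x → identityˡ (proj₁ x)) , (λ x → identityʳ (proj₁ x))
          }
        ; inverse = (λ x → inverseˡ (proj₁ x)) , (λ x → inverseʳ (proj₁ x))
        ; ⁻¹-cong = ⁻¹-cong
        }
      ; comm = λ x y → comm (proj₁ x) (proj₁ y)
      }
    }

-- ℤ₂ is the library's group of parities under addition.
ℤ₂^_ : ℕ → AbelianGroup 0ℓ 0ℓ
ℤ₂^ k = Pointwise.abelianGroup (Fin k) ℤ₂

𝒜 : TripleSet m n p → AbelianGroup 0ℓ 0ℓ
𝒜 {m} {n} {p} P = presentedGroup {X = Vertex m n p} {I = Σ[ t ∈ Triple m n p ] t ∈ P}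
  λ ((r , c , s) , _) → gen (row r) + gen (column c) + gen (symbol s)
  where open Presentation

canonicalGroup : SphericalLatinBitrade → AbelianGroup 0ℓ 0ℓ
canonicalGroup T = torsionSubgroup (𝒜 W)
  where open SphericalLatinBitrade T

{-# OPTIONS --safe #-}
module Submission where

-- For x : V → ℤ on the set V of rows, columns and symbols let ⟪ x , t ⟫ be the sum of x
-- over the vertices of a triple t.  Every edge lies in one white and one black triangle,
-- so ∑_W ⟪ x , t ⟫ ⟪ y , t ⟫ = ∑_B ⟪ x , t ⟫ ⟪ y , t ⟫.  By Euler's formula |V| = |W| + 2,
-- and connectedness makes the common kernel of the sizes ⟪ - , t ⟫ two-dimensional, so
-- for each b ∈ B some z has size μ ≠ 0 at b and size 0 at the other black triples.  Then
-- μ b = ∑_W ⟪ z , w ⟫ w in 𝒜_W, so b represents a torsion element.  If torsion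
-- has exponent 2, then 2 b = ∑_W u_w w in the free abelian group on V with integers u_w, and
-- 2 ⟪ z , w ⟫ = μ u_w.  Hence the vectors u of the black triples are pairwise orthogonal of
-- squared length 4.  This forces u to be 1 on the three mates of b, -1 on a fourth white
-- triple made up of the new vertices of these mates, and 0 elsewhere; orthogonality to the
-- neighbouring black triples then completes an octahedron, which is the whole
-- bitrade by connectedness.  Its canonical group has only two elements.

open import Defs
open import Algebra.Bundles using (AbelianGroup)
open import Algebra.Morphism.Structures using (module GroupMorphisms)
import Algebra.Properties.AbelianGroup as AbelianGroupProperties
import Algebra.Properties.CommutativeMonoid.Mult as Mult
import Algebra.Properties.CommutativeSemigroup as CommutativeSemigroupProperties
open import Data.Bool.Base using (Bool; true; false; T; not; _∧_; _xor_; if_then_else_)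
open import Data.Bool.ListAction using (any)
open import Data.Bool.Properties using (T-∧; T?)
open import Data.Empty using (⊥; ⊥-elim)
open import Data.Fin.Base using (Fin; zero; suc; punchIn; _↑ˡ_; _↑ʳ_; splitAt)
open import Data.Fin.Properties using (any?; punchInᵢ≢i; join-splitAt) renaming (_≟_ to _≟ᶠ_)
open import Data.Integer.Base as ℤ
  using (ℤ; _+_; _*_; -_; _-_; _⊖_; _≤_; _<_; 0ℤ; 1ℤ; -1ℤ)
import Data.Integer.Properties as ℤₚ
open import Data.Integer.Tactic.RingSolver using (solve-∀)
open import Data.List.Base as List
  using (List; []; _∷_; _++_; length; lookup; filterᵇ; allFin; cartesianProduct)
open import Data.List.Membership.Propositional using (lose) renaming (_∈_ to _∈ₗ_)
open import Data.List.Membership.Propositional.Properties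
  using (∈-allFin; ∈-cartesianProduct⁺; ∈-filter⁺; ∈-filter⁻; ∈-map⁺; ∈-map⁻; ∈-++⁺ˡ; ∈-++⁺ʳ; ∈-++⁻)
open import Data.List.Relation.Unary.All as All using (All; []; _∷_)
open import Data.List.Relation.Unary.Any as Any using (here; there; satisfied; index)
open import Data.List.Relation.Unary.Any.Properties using (any⁺; any⁻; lookup-index)
open import Data.List.Relation.Unary.Unique.Propositional using (Unique; []; _∷_)
import Data.List.Relation.Unary.Unique.Propositional.Properties as Unique
open import Data.Nat.Base as ℕ using (ℕ; zero; suc)
import Data.Nat.Properties as ℕₚ
import Data.Nat.Tactic.RingSolver as ℕ-Solver
open import Data.Parity.Base using (Parity; 0ℙ; 1ℙ)
open import Data.Parity.Properties using (p+p≡0ℙ)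
open import Data.Product using (∃; ∃₂; _×_; _,_; proj₁; proj₂)
open import Data.Product.Base using (Σ-syntax)
open import Data.Product.Properties using (≡-dec)
open import Data.Sum.Base using (_⊎_; inj₁; inj₂)
open import Data.Vec.Functional using (insertAt; removeAt)
open import Data.Vec.Functional.Properties using (insertAt-lookup; insertAt-punchIn)
open import Function.Base using (_∘_)
open import Function.Bundles using (module Equivalence)
open import Relation.Binary.Definitions using (DecidableEquality)
open import Relation.Binary.PropositionalEquality as ≡
  using (_≡_; _≢_; refl; sym; trans; cong; cong₂; subst; module ≡-Reasoning)
open import Relation.Nullary using (¬_; ¬?; Dec; yes; no; does; contradiction)
open import Relation.Nullary.Decidable as Dec
  using (decidable-stable; dec-true; dec-false; ⌊_⌋; toWitness; fromWitness)

open import Algebra.Properties.CommutativeSemigroup ℤₚ.+-commutativeSemigroup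
  using () renaming (interchange to +-interchange)
import Algebra.Properties.AbelianGroup ℤₚ.+-0-abelianGroup as ℤ+
open import Algebra.Properties.Semiring.Sum ℤₚ.+-*-semiring
  using (sum; sum-remove; sum-cong-≗; *-distribˡ-sum; ∑-distrib-+)

-- Over the rationals the triples of either colour are independent and span the same space, and the
-- equality of the two sums of products says that the matrix expressing black triples through white
-- ones is orthogonal. Torsion of exponent 2 makes twice this matrix integral. The vectors `u` are
-- the rows of the doubled matrix, the number 4 is the square of 2, and integrality leaves few
-- possible shapes for a row. Equality in 𝒜_W is an inductively generated relation, from which no
-- coefficient can be read off. It is therefore moved to ℤ: a term is evaluated at arbitrary
-- functions on the vertices, an equality becomes an integer combination of white triples under
-- every such evaluation, and single coefficients are isolated by functions whose size vanishes at
-- all white triples but one.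

private
  variable
    X Y : Set
    m n p : ℕ

-- Sums over lists

∑ : List X → (X → ℤ) → ℤ
∑ []       f = 0ℤ
∑ (x ∷ xs) f = f x + ∑ xs f

∑-congᴸ : ∀ (xs : List X) {f g : X → ℤ} → (∀ {x} → x ∈ₗ xs → f x ≡ g x) → ∑ xs f ≡ ∑ xs g
∑-congᴸ []       f≗g = refl
∑-congᴸ (x ∷ xs) f≗g = cong₂ _+_ (f≗g (here refl)) (∑-congᴸ xs (f≗g ∘ there))

∑-cong : ∀ (xs : List X) {f g : X → ℤ} → (∀ x → f x ≡ g x) → ∑ xs f ≡ ∑ xs g
∑-cong xs f≗g = ∑-congᴸ xs λ {x} _ → f≗g x

∑-0 : ∀ (xs : List X) → ∑ xs (λ _ → 0ℤ) ≡ 0ℤ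
∑-0 []       = refl
∑-0 (x ∷ xs) = trans (ℤₚ.+-identityˡ _) (∑-0 xs)

∑-zero : ∀ (xs : List X) {f : X → ℤ} → (∀ {x} → x ∈ₗ xs → f x ≡ 0ℤ) → ∑ xs f ≡ 0ℤ
∑-zero xs f≗0 = trans (∑-congᴸ xs f≗0) (∑-0 xs)

∑-+ : ∀ (xs : List X) (f g : X → ℤ) → ∑ xs (λ x → f x + g x) ≡ ∑ xs f + ∑ xs g
∑-+ []       f g = refl
∑-+ (x ∷ xs) f g = trans (cong ((f x + g x) +_) (∑-+ xs f g)) (+-interchange (f x) (g x) _ _)

∑-*ˡ : ∀ (xs : List X) a (f : X → ℤ) → ∑ xs (λ x → a * f x) ≡ a * ∑ xs f
∑-*ˡ []       a f = sym (ℤₚ.*-zeroʳ a)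
∑-*ˡ (x ∷ xs) a f = trans (cong ((a * f x) +_) (∑-*ˡ xs a f)) (sym (ℤₚ.*-distribˡ-+ a (f x) _))

∑-neg : ∀ (xs : List X) (f : X → ℤ) → ∑ xs (λ x → - f x) ≡ - ∑ xs f
∑-neg []       f = refl
∑-neg (x ∷ xs) f = trans (cong ((- f x) +_) (∑-neg xs f)) (sym (ℤₚ.neg-distrib-+ (f x) _))

∑-swap : ∀ (xs : List X) (ys : List Y) (f : X → Y → ℤ) →
         ∑ xs (λ x → ∑ ys (f x)) ≡ ∑ ys (λ y → ∑ xs (λ x → f x y))
∑-swap []       ys f = sym (∑-0 ys)
∑-swap (x ∷ xs) ys f =
  trans (cong ((∑ ys (f x)) +_) (∑-swap xs ys f)) (sym (∑-+ ys (f x) _))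

∑-++ : ∀ (xs ys : List X) (f : X → ℤ) → ∑ (xs ++ ys) f ≡ ∑ xs f + ∑ ys f
∑-++ []       ys f = sym (ℤₚ.+-identityˡ _)
∑-++ (x ∷ xs) ys f = trans (cong (f x +_) (∑-++ xs ys f)) (sym (ℤₚ.+-assoc (f x) _ _))

∑-map : ∀ (xs : List X) (g : X → Y) (f : Y → ℤ) → ∑ (List.map g xs) f ≡ ∑ xs (f ∘ g)
∑-map []       g f = refl
∑-map (x ∷ xs) g f = cong (f (g x) +_) (∑-map xs g f)

∑-cartesianProduct : ∀ (xs : List X) (ys : List Y) (f : X × Y → ℤ) →
                     ∑ (cartesianProduct xs ys) f ≡ ∑ xs (λ x → ∑ ys (λ y → f (x , y)))
∑-cartesianProduct []       ys f = refl
∑-cartesianProduct (x ∷ xs) ys f =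
  trans (∑-++ (List.map (x ,_) ys) _ f)
        (cong₂ _+_ (∑-map ys (x ,_) f) (∑-cartesianProduct xs ys f))

[_] : Bool → ℤ
[ true  ] = 1ℤ
[ false ] = 0ℤ

∑-filter : ∀ (p : X → Bool) xs (f : X → ℤ) → ∑ (filterᵇ p xs) f ≡ ∑ xs (λ x → [ p x ] * f x)
∑-filter p []       f = refl
∑-filter p (x ∷ xs) f with p x
... | true  = cong₂ _+_ (sym (ℤₚ.*-identityˡ (f x))) (∑-filter p xs f)
... | false = trans (∑-filter p xs f) (sym (ℤₚ.+-identityˡ _))

∑-1 : ∀ (xs : List X) → ∑ xs (λ _ → 1ℤ) ≡ ℤ.+ length xs
∑-1 []       = refl
∑-1 (x ∷ xs) = cong (1ℤ +_) (∑-1 xs)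

length-filter : ∀ (p : X → Bool) xs → ℤ.+ length (filterᵇ p xs) ≡ ∑ xs (λ x → [ p x ])
length-filter p xs = trans (sym (∑-1 (filterᵇ p xs)))
  (trans (∑-filter p xs _) (∑-cong xs λ x → ℤₚ.*-identityʳ [ p x ]))

∑-mono : ∀ (xs : List X) {f g : X → ℤ} → (∀ {x} → x ∈ₗ xs → f x ≤ g x) → ∑ xs f ≤ ∑ xs g
∑-mono []       f≤g = ℤₚ.≤-refl
∑-mono (x ∷ xs) f≤g = ℤₚ.+-mono-≤ (f≤g (here refl)) (∑-mono xs (f≤g ∘ there))

∑-nonneg : ∀ (xs : List X) {f : X → ℤ} → (∀ {x} → x ∈ₗ xs → 0ℤ ≤ f x) → 0ℤ ≤ ∑ xs f
∑-nonneg xs 0≤f = subst (_≤ ∑ xs _) (∑-0 xs) (∑-mono xs 0≤f)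

term≤∑ : ∀ (xs : List X) {f : X → ℤ} → (∀ {x} → x ∈ₗ xs → 0ℤ ≤ f x) →
         ∀ {a} → a ∈ₗ xs → f a ≤ ∑ xs f
term≤∑ (x ∷ xs) {f} 0≤f (here refl) =
  subst (_≤ f x + ∑ xs f) (ℤₚ.+-identityʳ (f x)) (ℤₚ.+-monoʳ-≤ (f x) (∑-nonneg xs (0≤f ∘ there)))
term≤∑ (x ∷ xs) {f} 0≤f {a} (there a∈xs) =
  subst (_≤ f x + ∑ xs f) (ℤₚ.+-identityˡ (f a))
    (ℤₚ.+-mono-≤ (0≤f (here refl)) (term≤∑ xs (0≤f ∘ there) a∈xs))

two-terms≤∑ : ∀ (xs : List X) {f : X → ℤ} → (∀ {x} → x ∈ₗ xs → 0ℤ ≤ f x) →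
              ∀ {a b} → a ∈ₗ xs → b ∈ₗ xs → a ≢ b → f a + f b ≤ ∑ xs f
two-terms≤∑ (x ∷ xs) 0≤f (here refl)  (here refl)  a≢b = contradiction refl a≢b
two-terms≤∑ (x ∷ xs) {f} 0≤f (here refl)  (there b∈xs) a≢b =
  ℤₚ.+-monoʳ-≤ (f x) (term≤∑ xs (0≤f ∘ there) b∈xs)
two-terms≤∑ (x ∷ xs) {f} 0≤f {a} (there a∈xs) (here refl)  a≢b =
  subst (_≤ f x + ∑ xs f) (ℤₚ.+-comm (f x) (f a)) (ℤₚ.+-monoʳ-≤ (f x) (term≤∑ xs (0≤f ∘ there) a∈xs))
two-terms≤∑ (x ∷ xs) {f} 0≤f (there a∈xs) (there b∈xs) a≢b =
  subst (_≤ f x + ∑ xs f) (ℤₚ.+-identityˡ _)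
    (ℤₚ.+-mono-≤ (0≤f (here refl)) (two-terms≤∑ xs (0≤f ∘ there) a∈xs b∈xs a≢b))

∑≡0⇒terms≡0 : ∀ (xs : List X) {f : X → ℤ} → (∀ {x} → x ∈ₗ xs → 0ℤ ≤ f x) → ∑ xs f ≡ 0ℤ →
              ∀ {a} → a ∈ₗ xs → f a ≡ 0ℤ
∑≡0⇒terms≡0 xs 0≤f ∑≡0 a∈xs =
  ℤₚ.≤-antisym (subst (_ ≤_) ∑≡0 (term≤∑ xs 0≤f a∈xs)) (0≤f a∈xs)

∑-single : ∀ {xs : List X} {f : X → ℤ} {a} → Unique xs → a ∈ₗ xs →
           (∀ {x} → x ∈ₗ xs → x ≢ a → f x ≡ 0ℤ) → ∑ xs f ≡ f a
∑-single {xs = x ∷ xs} {f} (x∉xs ∷ _) (here refl) f≗0 =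
  trans (cong (f x +_) (∑-zero xs λ y∈xs →
          f≗0 (there y∈xs) λ { refl → All.lookup x∉xs y∈xs refl }))
        (ℤₚ.+-identityʳ (f x))
∑-single {xs = x ∷ xs} (x∉xs ∷ xs!) (there a∈xs) f≗0 =
  trans (cong₂ _+_ (f≗0 (here refl) (All.lookup x∉xs a∈xs)) (∑-single xs! a∈xs (f≗0 ∘ there)))
        (ℤₚ.+-identityˡ _)

-- This produces new white triples: a known positive term of a vanishing sum has to be cancelled
-- somewhere else.
negative-term : ∀ (xs : List X) (f : X → ℤ) {a} → a ∈ₗ xs → 0ℤ < f a → ∑ xs f ≤ 0ℤ →
                ∃ λ b → b ∈ₗ xs × f b < 0ℤ
negative-term xs f a∈xs 0<fa ∑≤0 with All.all? (λ x → 0ℤ ℤₚ.≤? f x) xs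
... | yes 0≤f = contradiction
  (ℤₚ.≤-trans (term≤∑ xs (All.lookup 0≤f) a∈xs) ∑≤0) (ℤₚ.<⇒≱ 0<fa)
... | no ¬0≤f = find xs ¬0≤f
  where
  find : ∀ ys → ¬ All (λ x → 0ℤ ≤ f x) ys → ∃ λ b → b ∈ₗ ys × f b < 0ℤ
  find []       ¬all = contradiction [] ¬all
  find (y ∷ ys) ¬all with 0ℤ ℤₚ.≤? f y
  ... | no 0≰fy = y , here refl , ℤₚ.≰⇒> 0≰fy
  ... | yes 0≤fy with b , b∈ys , fb<0 ← find ys (¬all ∘ (0≤fy ∷_)) = b , there b∈ys , fb<0

-- Homogeneous systems

dot : ∀ {N} → (Fin N → ℤ) → (Fin N → ℤ) → ℤ
dot f x = sum (λ i → f i * x i)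

sum≡0 : ∀ {N} {f : Fin N → ℤ} → (∀ i → f i ≡ 0ℤ) → sum f ≡ 0ℤ
sum≡0 {zero}  f≗0 = refl
sum≡0 {suc N} f≗0 = cong₂ _+_ (f≗0 zero) (sum≡0 (f≗0 ∘ suc))

dot-linear : ∀ {N} a b (f g x : Fin N → ℤ) →
             dot (λ i → a * f i + b * g i) x ≡ a * dot f x + b * dot g x
dot-linear a b f g x = begin
  sum (λ i → (a * f i + b * g i) * x i)
    ≡⟨ sum-cong-≗ (λ i → expand a b (f i) (g i) (x i)) ⟩
  sum (λ i → a * (f i * x i) + b * (g i * x i))
    ≡⟨ ∑-distrib-+ (λ i → a * (f i * x i)) (λ i → b * (g i * x i)) ⟩
  sum (λ i → a * (f i * x i)) + sum (λ i → b * (g i * x i))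
    ≡⟨ cong₂ _+_ (*-distribˡ-sum a (λ i → f i * x i)) (*-distribˡ-sum b (λ i → g i * x i)) ⟨
  a * dot f x + b * dot g x ∎
  where
  open ≡-Reasoning
  expand : ∀ a b f g x → (a * f + b * g) * x ≡ a * (f * x) + b * (g * x)
  expand = solve-∀

NonzeroSolution : ∀ {k N} → (Fin k → Fin N → ℤ) → Set
NonzeroSolution F = ∃ λ x → (∃ λ i → x i ≢ 0ℤ) × (∀ e → dot (F e) x ≡ 0ℤ)

module Elimination {k N} (F : Fin (suc k) → Fin (suc N) → ℤ) (j : Fin (suc N)) where

  -- Elimination without fractions: each equation is multiplied by the pivot instead of dividing by
  -- it, so that all coefficients stay in ℤ.
  eliminate : Fin k → Fin N → ℤ
  eliminate e i = F zero j * F (suc e) (punchIn j i) + - F (suc e) j * F zero (punchIn j i)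

  back-substitute : F zero j ≢ 0ℤ → NonzeroSolution eliminate → NonzeroSolution F
  back-substitute c≢0 (x , (i , xᵢ≢0) , Gx≡0) = y , (punchIn j i , yᵢ≢0) , λ where
      zero    → trans (Fy≡ zero) (cancel c d)
      (suc e) → trans (Fy≡ (suc e)) (trans (rearrange c d (F (suc e) j) _) (trans
        (sym (dot-linear c (- F (suc e) j) (removeAt (F (suc e)) j) (removeAt (F zero) j) x)) (Gx≡0 e)))
    where
    open ≡-Reasoning
    c = F zero j
    d = dot (removeAt (F zero) j) x
    -- Scaling the old unknowns by the pivot `c` allows the eliminated one to be solved for in ℤ; as
    -- `c` is nonzero, the solution remains nonzero.
    y = insertAt (λ i → c * x i) j (- d)
    yᵢ≢0 : y (punchIn j i) ≢ 0ℤ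
    yᵢ≢0 yᵢ≡0 with ℤₚ.i*j≡0⇒i≡0∨j≡0 c (trans (sym (insertAt-punchIn (λ i → c * x i) j (- d) i)) yᵢ≡0)
    ... | inj₁ c≡0  = c≢0 c≡0
    ... | inj₂ xᵢ≡0 = xᵢ≢0 xᵢ≡0
    swap* : ∀ a b c → a * (b * c) ≡ b * (a * c)
    swap* = solve-∀
    Fy≡ : ∀ e → dot (F e) y ≡ F e j * - d + c * dot (removeAt (F e) j) x
    Fy≡ e = begin
      dot (F e) y
        ≡⟨ sum-remove {i = j} (λ i → F e i * y i) ⟩
      F e j * y j + sum (λ i → F e (punchIn j i) * y (punchIn j i))
        ≡⟨ cong₂ _+_ (cong (F e j *_) (insertAt-lookup (λ i → c * x i) j (- d)))
                     (sum-cong-≗ λ i → trans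
                       (cong (F e (punchIn j i) *_) (insertAt-punchIn (λ i → c * x i) j (- d) i))
                       (swap* (F e (punchIn j i)) c (x i))) ⟩
      F e j * - d + sum (λ i → c * (F e (punchIn j i) * x i))
        ≡⟨ cong ((F e j * - d) +_) (*-distribˡ-sum c (λ i → F e (punchIn j i) * x i)) ⟨
      F e j * - d + c * dot (removeAt (F e) j) x ∎
    cancel : ∀ c d → c * - d + c * d ≡ 0ℤ
    cancel = solve-∀
    rearrange : ∀ c d f g → f * - d + c * g ≡ c * g + - f * d
    rearrange = solve-∀

open Elimination

abstract
  -- Induction on the number of equations. A pivot in the first equation removes one equation and
  -- one unknown; without a pivot that equation is identically zero and is dropped.
  homogeneous-solution : ∀ {k N} → k ℕ.< N → (F : Fin k → Fin N → ℤ) → NonzeroSolution F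
  homogeneous-solution {zero} {suc N} _ F = (λ _ → 1ℤ) , (zero , λ ()) , λ ()
  homogeneous-solution {suc k} {suc N} k<N F with any? (λ j → ¬? (F zero j ℤₚ.≟ 0ℤ))
  ... | yes (j , c≢0) =
    back-substitute F j c≢0 (homogeneous-solution (ℕ.s<s⁻¹ k<N) (eliminate F j))
  ... | no F₀≡0 with x , x≢0 , Fx≡0 ← homogeneous-solution (ℕₚ.<-trans (ℕₚ.n<1+n k) k<N) (F ∘ suc) =
    x , x≢0 , λ where
      zero → sum≡0 λ j → cong (_* x j)
        (decidable-stable (F zero j ℤₚ.≟ 0ℤ) λ F₀j≢0 → F₀≡0 (j , F₀j≢0))
      (suc e) → Fx≡0 e

δ : ∀ {N} → Fin N → Fin N → ℤ
δ j i = [ does (i ≟ᶠ j) ]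

dot-δ : ∀ {N} (j : Fin N) (x : Fin N → ℤ) → dot (δ j) x ≡ x j
dot-δ {suc N} j x = begin
  dot (δ j) x
    ≡⟨ sum-remove {i = j} (λ i → δ j i * x i) ⟩
  δ j j * x j + dot (removeAt (δ j) j) (removeAt x j)
    ≡⟨ cong₂ _+_ (cong (λ b → [ b ] * x j) (dec-true (j ≟ᶠ j) refl))
                 (sum≡0 λ i → cong (λ b → [ b ] * x (punchIn j i))
                   (dec-false (punchIn j i ≟ᶠ j) (punchInᵢ≢i j i))) ⟩
  1ℤ * x j + 0ℤ
    ≡⟨ simplify (x j) ⟩
  x j ∎
  where
  open ≡-Reasoning
  simplify : ∀ a → 1ℤ * a + 0ℤ ≡ a
  simplify = solve-∀

-- Triples and their vertices

-- Naming the three coordinates allows arguments that are symmetric in rows, columns and symbols to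
-- be given once.
data Axis : Set where
  rows columns symbols : Axis

_≟ₐ_ : DecidableEquality Axis
rows    ≟ₐ rows    = yes refl
rows    ≟ₐ columns = no λ ()
rows    ≟ₐ symbols = no λ ()
columns ≟ₐ rows    = no λ ()
columns ≟ₐ columns = yes refl
columns ≟ₐ symbols = no λ ()
symbols ≟ₐ rows    = no λ ()
symbols ≟ₐ columns = no λ ()
symbols ≟ₐ symbols = yes refl

infixl 9 _!_

_!_ : Triple m n p → Axis → Vertex m n p
(r , c , s) ! rows    = row r
(r , c , s) ! columns = column c
(r , c , s) ! symbols = symbol s

infix 4 _~[_]_ _≟ₐ_ _≟ₜ_ _≟ᵥ_

_~[_]_ : Triple m n p → Axis → Triple m n p → Set
t ~[ α ] t′ = ∀ β → β ≢ α → t ! β ≡ t′ ! β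

~-sym : ∀ {α} {t t′ : Triple m n p} → t ~[ α ] t′ → t′ ~[ α ] t
~-sym t~t′ β β≢α = sym (t~t′ β β≢α)

_≟ₜ_ : DecidableEquality (Triple m n p)
_≟ₜ_ = ≡-dec _≟ᶠ_ (≡-dec _≟ᶠ_ _≟ᶠ_)

row-injective : ∀ {i j} → row {m} {n} {p} i ≡ row j → i ≡ j
row-injective refl = refl

column-injective : ∀ {i j} → column {m} {n} {p} i ≡ column j → i ≡ j
column-injective refl = refl

symbol-injective : ∀ {i j} → symbol {m} {n} {p} i ≡ symbol j → i ≡ j
symbol-injective refl = refl

_≟ᵥ_ : DecidableEquality (Vertex m n p)
row i    ≟ᵥ row j    = Dec.map′ (cong row) row-injective (i ≟ᶠ j)
column i ≟ᵥ column j = Dec.map′ (cong column) column-injective (i ≟ᶠ j)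
symbol i ≟ᵥ symbol j = Dec.map′ (cong symbol) symbol-injective (i ≟ᶠ j)
row _    ≟ᵥ column _ = no λ ()
row _    ≟ᵥ symbol _ = no λ ()
column _ ≟ᵥ row _    = no λ ()
column _ ≟ᵥ symbol _ = no λ ()
symbol _ ≟ᵥ row _    = no λ ()
symbol _ ≟ᵥ column _ = no λ ()

ι : Vertex m n p → Fin (m ℕ.+ n ℕ.+ p)
ι {m} {n} {p} (row i)    = (i ↑ˡ n) ↑ˡ p
ι {m} {n} {p} (column j) = (m ↑ʳ j) ↑ˡ p
ι {m} {n} {p} (symbol k) = (m ℕ.+ n) ↑ʳ k

-- Linear systems have their unknowns numbered by `Fin`; this turns a nonzero coordinate of a
-- solution back into a vertex.
ι-surjective : ∀ (i : Fin (m ℕ.+ n ℕ.+ p)) → ∃ λ v → ι {m} {n} {p} v ≡ i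
ι-surjective {m} {n} {p} i with splitAt (m ℕ.+ n) i | join-splitAt (m ℕ.+ n) p i
... | inj₂ k | eq = symbol k , eq
... | inj₁ h | eq with splitAt m h | join-splitAt m n h
... | inj₁ r | eq′ = row r , trans (cong (_↑ˡ p) eq′) eq
... | inj₂ c | eq′ = column c , trans (cong (_↑ˡ p) eq′) eq

⟪_,_⟫ : (Vertex m n p → ℤ) → Triple m n p → ℤ
⟪ x , (r , c , s) ⟫ = x (row r) + x (column c) + x (symbol s)

triples : ∀ m n p → List (Triple m n p)
triples m n p = cartesianProduct (allFin m) (cartesianProduct (allFin n) (allFin p))

elements : TripleSet m n p → List (Triple m n p)
elements {m} {n} {p} P = filterᵇ P (triples m n p)

elements-unique : ∀ (P : TripleSet m n p) → Unique (elements P)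
elements-unique {m} {n} {p} P = Unique.filter⁺ (T? ∘ P)
  (Unique.cartesianProduct⁺ (Unique.allFin⁺ m)
    (Unique.cartesianProduct⁺ (Unique.allFin⁺ n) (Unique.allFin⁺ p)))

∈-elements⁺ : ∀ (P : TripleSet m n p) {t} → t ∈ P → t ∈ₗ elements P
∈-elements⁺ P = ∈-filter⁺ (T? ∘ P)
  (∈-cartesianProduct⁺ (∈-allFin _) (∈-cartesianProduct⁺ (∈-allFin _) (∈-allFin _)))

∈-elements⁻ : ∀ (P : TripleSet m n p) {t} → t ∈ₗ elements P → t ∈ P
∈-elements⁻ {m} {n} {p} P = proj₂ ∘ ∈-filter⁻ (T? ∘ P) {xs = triples m n p}

∑-triples : ∀ (f : Triple m n p → ℤ) →
  ∑ (triples m n p) f ≡ ∑ (allFin m) (λ r → ∑ (allFin n) (λ c → ∑ (allFin p) (λ s → f (r , c , s))))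
∑-triples {m} {n} {p} f = trans (∑-cartesianProduct (allFin m) _ f)
  (∑-cong (allFin m) λ r → ∑-cartesianProduct (allFin n) (allFin p) _)

any-⇔ : ∀ {N} (f g : Fin N → Bool) → (∀ i → T (f i) → ∃ (T ∘ g)) → (∀ i → T (g i) → ∃ (T ∘ f)) →
        any f (allFin N) ≡ any g (allFin N)
any-⇔ {N} f g f⇒g g⇒f = T-injective (transfer f g f⇒g) (transfer g f g⇒f)
  where
  T-injective : ∀ {a b} → (T a → T b) → (T b → T a) → a ≡ b
  T-injective {true}  {true}  _ _ = refl
  T-injective {true}  {false} h _ = ⊥-elim (h _)
  T-injective {false} {true}  _ h = ⊥-elim (h _)
  T-injective {false} {false} _ _ = refl
  transfer : ∀ (f g : Fin N → Bool) → (∀ i → T (f i) → ∃ (T ∘ g)) →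
             T (any f (allFin N)) → T (any g (allFin N))
  transfer f g h tf with i , fi ← satisfied (any⁻ f (allFin N) tf) with j , gj ← h i fi =
    any⁺ g (lose (∈-allFin j) gj)

[]-true : ∀ {b} → T b → [ b ] ≡ 1ℤ
[]-true {true} _ = refl

[]-false : ∀ {b} → ¬ T b → [ b ] ≡ 0ℤ
[]-false {true}  ¬b = contradiction _ ¬b
[]-false {false} _  = refl

-- For a line that meets a partial latin square at most once, the count along it only records
-- whether the line is an edge.
∑-line : ∀ {N} (f : Fin N → Bool) → (∀ {i j} → T (f i) → T (f j) → i ≡ j) →
         ∑ (allFin N) (λ i → [ f i ]) ≡ [ any f (allFin N) ]
∑-line {N} f atMostOne with T? (any f (allFin N))
... | yes ∃f with i , fi ← satisfied (any⁻ f (allFin N) ∃f) =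
  trans (∑-single (Unique.allFin⁺ N) (∈-allFin i) λ {j} _ j≢i → []-false λ fj → j≢i (atMostOne fj fi))
        (trans ([]-true fi) (sym ([]-true ∃f)))
... | no ¬∃f = trans (∑-zero (allFin N) λ {i} i∈ → []-false λ fi → ¬∃f (any⁺ f (lose i∈ fi)))
                     (sym ([]-false ¬∃f))

-- Mates in a bitrade, with either colour in the first place

module Bitrade {P Q : TripleSet m n p} (bitrade : IsLatinBitrade P Q) where

  open IsLatinBitrade bitrade using () renaming (W-partialLatinSquare to P-pls; W-mates to P-mates)

  module _ {t t′ : Triple m n p} (t∈P : t ∈ P) (t′∈P : t′ ∈ P) where

    private
      stable : ¬ t ≢ t′ → t ≡ t′
      stable = decidable-stable (t ≟ₜ t′)

    agree-rc : t ! rows ≡ t′ ! rows → t ! columns ≡ t′ ! columns → t ≡ t′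
    agree-rc eq eq′ = stable λ t≢t′ →
      proj₁ (P-pls t∈P t′∈P t≢t′) (row-injective eq , column-injective eq′)

    agree-rs : t ! rows ≡ t′ ! rows → t ! symbols ≡ t′ ! symbols → t ≡ t′
    agree-rs eq eq′ = stable λ t≢t′ →
      proj₁ (proj₂ (P-pls t∈P t′∈P t≢t′)) (row-injective eq , symbol-injective eq′)

    agree-cs : t ! columns ≡ t′ ! columns → t ! symbols ≡ t′ ! symbols → t ≡ t′
    agree-cs eq eq′ = stable λ t≢t′ →
      proj₂ (proj₂ (P-pls t∈P t′∈P t≢t′)) (column-injective eq , symbol-injective eq′)

    agree-twice : ∀ {α β} → α ≢ β → t ! α ≡ t′ ! α → t ! β ≡ t′ ! β → t ≡ t′
    agree-twice {rows}    {columns} _ = agree-rc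
    agree-twice {rows}    {symbols} _ = agree-rs
    agree-twice {columns} {symbols} _ = agree-cs
    agree-twice {columns} {rows}    _ eq eq′ = agree-rc eq′ eq
    agree-twice {symbols} {rows}    _ eq eq′ = agree-rs eq′ eq
    agree-twice {symbols} {columns} _ eq eq′ = agree-cs eq′ eq
    agree-twice {rows}    {rows}    α≢β = contradiction refl α≢β
    agree-twice {columns} {columns} α≢β = contradiction refl α≢β
    agree-twice {symbols} {symbols} α≢β = contradiction refl α≢β

    ~⇒≡ : ∀ {α} → t ~[ α ] t′ → t ≡ t′
    ~⇒≡ {rows}    t~t′ = agree-cs (t~t′ columns λ ()) (t~t′ symbols λ ())
    ~⇒≡ {columns} t~t′ = agree-rs (t~t′ rows λ ()) (t~t′ symbols λ ())
    ~⇒≡ {symbols} t~t′ = agree-rc (t~t′ rows λ ()) (t~t′ columns λ ())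

  abstract
    mate : ∀ {t} → t ∈ P → ∀ α → ∃ λ t′ → t′ ∈ Q × t′ ~[ α ] t × t′ ! α ≢ t ! α
    mate {r , c , s} t∈P rows with r′ , (r′≢r , t′∈Q) , _ ← proj₁ (P-mates t∈P) =
      (r′ , c , s) , t′∈Q ,
      (λ { rows α≢α → contradiction refl α≢α ; columns _ → refl ; symbols _ → refl }) ,
      r′≢r ∘ row-injective
    mate {r , c , s} t∈P columns with c′ , (c′≢c , t′∈Q) , _ ← proj₁ (proj₂ (P-mates t∈P)) =
      (r , c′ , s) , t′∈Q ,
      (λ { columns α≢α → contradiction refl α≢α ; rows _ → refl ; symbols _ → refl }) ,
      c′≢c ∘ column-injective
    mate {r , c , s} t∈P symbols with s′ , (s′≢s , t′∈Q) , _ ← proj₂ (proj₂ (P-mates t∈P)) =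
      (r , c , s′) , t′∈Q ,
      (λ { symbols α≢α → contradiction refl α≢α ; rows _ → refl ; columns _ → refl }) ,
      s′≢s ∘ symbol-injective

swap-bitrade : {P Q : TripleSet m n p} → IsLatinBitrade P Q → IsLatinBitrade Q P
swap-bitrade bitrade = record
  { W-nonEmpty = B-nonEmpty
  ; B-nonEmpty = W-nonEmpty
  ; W-partialLatinSquare = B-partialLatinSquare
  ; B-partialLatinSquare = W-partialLatinSquare
  ; W-mates = B-mates
  ; B-mates = W-mates
  }
  where open IsLatinBitrade bitrade

swap-connected : {P Q : TripleSet m n p} → Connected P Q → Connected Q P
swap-connected connected (Q′ , P′ , bitrade , Q′⊊Q , P′⊊P) =
  connected (P′ , Q′ , swap-bitrade bitrade , P′⊊P , Q′⊊Q)

module _ {P Q : TripleSet m n p} (bitrade : IsLatinBitrade P Q) where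

  open Bitrade bitrade
  open Bitrade (swap-bitrade bitrade) using () renaming (~⇒≡ to ~⇒≡′)

  -- A common triple and its row mate would both lie in `Q` and agree off the row, so they would
  -- coincide.
  disjoint : ∀ {t} → t ∈ P → ¬ t ∈ Q
  disjoint t∈P t∈Q with t′ , t′∈Q , t′~t , t′≢t ← mate t∈P rows =
    t′≢t (cong (_! rows) (~⇒≡′ t′∈Q t∈Q t′~t))

  -- The symbol mate of a triple keeps its row and column, so the two colours have the same
  -- row-column edges.
  any-symbols : ∀ r c → any (λ s → P (r , c , s)) (allFin p) ≡ any (λ s → Q (r , c , s)) (allFin p)
  any-symbols r c = any-⇔ _ _
    (λ s t∈P → let s′ , (_ , t′∈Q) , _ = proj₂ (proj₂ (W-mates t∈P)) in s′ , t′∈Q)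
    (λ s t∈Q → let s′ , (_ , t′∈P) , _ = proj₂ (proj₂ (B-mates t∈Q)) in s′ , t′∈P)
    where open IsLatinBitrade bitrade

  any-columns : ∀ r s → any (λ c → P (r , c , s)) (allFin n) ≡ any (λ c → Q (r , c , s)) (allFin n)
  any-columns r s = any-⇔ _ _
    (λ c t∈P → let c′ , (_ , t′∈Q) , _ = proj₁ (proj₂ (W-mates t∈P)) in c′ , t′∈Q)
    (λ c t∈Q → let c′ , (_ , t′∈P) , _ = proj₁ (proj₂ (B-mates t∈Q)) in c′ , t′∈P)
    where open IsLatinBitrade bitrade

  any-rows : ∀ c s → any (λ r → P (r , c , s)) (allFin m) ≡ any (λ r → Q (r , c , s)) (allFin m)
  any-rows c s = any-⇔ _ _
    (λ r t∈P → let r′ , (_ , t′∈Q) , _ = proj₁ (W-mates t∈P) in r′ , t′∈Q)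
    (λ r t∈Q → let r′ , (_ , t′∈P) , _ = proj₁ (B-mates t∈Q) in r′ , t′∈P)
    where open IsLatinBitrade bitrade

-- Sums over edges and the balance between the colours

module LineSums {P Q : TripleSet m n p} (bitrade : IsLatinBitrade P Q) where

  open Bitrade bitrade

  ∑-elements : ∀ f → ∑ (elements P) f ≡
    ∑ (allFin m) (λ r → ∑ (allFin n) (λ c → ∑ (allFin p) (λ s → [ P (r , c , s) ] * f (r , c , s))))
  ∑-elements f = trans (∑-filter P (triples m n p) f) (∑-triples {m} {n} {p} _)

  ∑-symbols : ∀ r c → ∑ (allFin p) (λ s → [ P (r , c , s) ]) ≡ [ any (λ s → P (r , c , s)) (allFin p) ]
  ∑-symbols r c = ∑-line _ λ t∈P t′∈P →
    symbol-injective (cong (_! symbols) (agree-rc t∈P t′∈P refl refl))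

  ∑-columns : ∀ r s → ∑ (allFin n) (λ c → [ P (r , c , s) ]) ≡ [ any (λ c → P (r , c , s)) (allFin n) ]
  ∑-columns r s = ∑-line _ λ t∈P t′∈P →
    column-injective (cong (_! columns) (agree-rs t∈P t′∈P refl refl))

  ∑-rows : ∀ c s → ∑ (allFin m) (λ r → [ P (r , c , s) ]) ≡ [ any (λ r → P (r , c , s)) (allFin m) ]
  ∑-rows c s = ∑-line _ λ t∈P t′∈P →
    row-injective (cong (_! rows) (agree-cs t∈P t′∈P refl refl))

  factor : ∀ {N} (b : Fin N → Bool) h → ∑ (allFin N) (λ i → [ b i ] * h) ≡ h * ∑ (allFin N) (λ i → [ b i ])
  factor {N} b h = trans (∑-cong (allFin N) λ i → ℤₚ.*-comm [ b i ] h) (∑-*ˡ (allFin N) h _)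

  ∑-rc : ∀ (h : Fin m → Fin n → ℤ) → ∑ (elements P) (λ (r , c , s) → h r c) ≡
    ∑ (allFin m) (λ r → ∑ (allFin n) (λ c → h r c * [ any (λ s → P (r , c , s)) (allFin p) ]))
  ∑-rc h = trans (∑-elements _) (∑-cong (allFin m) λ r → ∑-cong (allFin n) λ c →
    trans (factor (λ s → P (r , c , s)) (h r c)) (cong (h r c *_) (∑-symbols r c)))

  ∑-rs : ∀ (h : Fin m → Fin p → ℤ) → ∑ (elements P) (λ (r , c , s) → h r s) ≡
    ∑ (allFin m) (λ r → ∑ (allFin p) (λ s → h r s * [ any (λ c → P (r , c , s)) (allFin n) ]))
  ∑-rs h = trans (∑-elements _) (∑-cong (allFin m) λ r →
    trans (∑-swap (allFin n) (allFin p) _) (∑-cong (allFin p) λ s →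
      trans (factor (λ c → P (r , c , s)) (h r s)) (cong (h r s *_) (∑-columns r s))))

  ∑-cs : ∀ (h : Fin n → Fin p → ℤ) → ∑ (elements P) (λ (r , c , s) → h c s) ≡
    ∑ (allFin n) (λ c → ∑ (allFin p) (λ s → h c s * [ any (λ r → P (r , c , s)) (allFin m) ]))
  ∑-cs h = trans (∑-elements _) (trans (∑-swap (allFin m) (allFin n) _) (∑-cong (allFin n) λ c →
    trans (∑-swap (allFin m) (allFin p) _) (∑-cong (allFin p) λ s →
      trans (factor (λ r → P (r , c , s)) (h c s)) (cong (h c s *_) (∑-rows c s)))))

module _ {P Q : TripleSet m n p} (bitrade : IsLatinBitrade P Q) where

  open LineSums bitrade
  open LineSums (swap-bitrade bitrade) using () renaming
    (∑-rc to ∑-rc′; ∑-rs to ∑-rs′; ∑-cs to ∑-cs′)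

  -- Both sides run once over each row-column edge, and the edges of the two colours are the same.
  balanced-rc : ∀ (h : Fin m → Fin n → ℤ) →
    ∑ (elements P) (λ (r , c , s) → h r c) ≡ ∑ (elements Q) (λ (r , c , s) → h r c)
  balanced-rc h = trans (∑-rc h) (trans
    (∑-cong (allFin m) λ r → ∑-cong (allFin n) λ c → cong (λ b → h r c * [ b ]) (any-symbols bitrade r c))
    (sym (∑-rc′ h)))

  balanced-rs : ∀ (h : Fin m → Fin p → ℤ) →
    ∑ (elements P) (λ (r , c , s) → h r s) ≡ ∑ (elements Q) (λ (r , c , s) → h r s)
  balanced-rs h = trans (∑-rs h) (trans
    (∑-cong (allFin m) λ r → ∑-cong (allFin p) λ s → cong (λ b → h r s * [ b ]) (any-columns bitrade r s))
    (sym (∑-rs′ h)))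

  balanced-cs : ∀ (h : Fin n → Fin p → ℤ) →
    ∑ (elements P) (λ (r , c , s) → h c s) ≡ ∑ (elements Q) (λ (r , c , s) → h c s)
  balanced-cs h = trans (∑-cs h) (trans
    (∑-cong (allFin n) λ c → ∑-cong (allFin p) λ s → cong (λ b → h c s * [ b ]) (any-rows bitrade c s))
    (sym (∑-cs′ h)))

  -- Every edge of the triangulation lies in one white and one black triangle.
  balanced : ∀ (x y : Vertex m n p → ℤ) →
    ∑ (elements P) (λ t → ⟪ x , t ⟫ * ⟪ y , t ⟫) ≡ ∑ (elements Q) (λ t → ⟪ x , t ⟫ * ⟪ y , t ⟫)
  balanced x y = begin
    ∑ (elements P) (λ t → ⟪ x , t ⟫ * ⟪ y , t ⟫)
      ≡⟨ split P ⟩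
    ∑ (elements P) (λ (r , c , s) → h r c) +
      (∑ (elements P) (λ (r , c , s) → h′ r s) + ∑ (elements P) (λ (r , c , s) → h″ c s))
      ≡⟨ cong₂ _+_ (balanced-rc h) (cong₂ _+_ (balanced-rs h′) (balanced-cs h″)) ⟩
    ∑ (elements Q) (λ (r , c , s) → h r c) +
      (∑ (elements Q) (λ (r , c , s) → h′ r s) + ∑ (elements Q) (λ (r , c , s) → h″ c s))
      ≡⟨ split Q ⟨
    ∑ (elements Q) (λ t → ⟪ x , t ⟫ * ⟪ y , t ⟫) ∎
    where
    open ≡-Reasoning
    -- Each of the nine monomials of the product involves at most two of the three coordinates and
    -- so belongs to a kind of edge. The monomials in a single coordinate could go with either of
    -- two kinds: those of rows and columns are put into `h`, that of symbols into `h″`.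
    h : Fin m → Fin n → ℤ
    h r c = (x (row r) + x (column c)) * (y (row r) + y (column c))
    h′ : Fin m → Fin p → ℤ
    h′ r s = x (row r) * y (symbol s) + x (symbol s) * y (row r)
    h″ : Fin n → Fin p → ℤ
    h″ c s = x (column c) * y (symbol s) + x (symbol s) * y (column c) + x (symbol s) * y (symbol s)
    expand : ∀ a b d a′ b′ d′ → (a + b + d) * (a′ + b′ + d′) ≡
      (a + b) * (a′ + b′) + ((a * d′ + d * a′) + (b * d′ + d * b′ + d * d′))
    expand = solve-∀
    split : ∀ R → ∑ (elements R) (λ t → ⟪ x , t ⟫ * ⟪ y , t ⟫) ≡
      ∑ (elements R) (λ (r , c , s) → h r c) +
        (∑ (elements R) (λ (r , c , s) → h′ r s) + ∑ (elements R) (λ (r , c , s) → h″ c s))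
    split R = trans
      (∑-cong (elements R) λ (r , c , s) →
        expand (x (row r)) (x (column c)) (x (symbol s)) (y (row r)) (y (column c)) (y (symbol s)))
      (trans (∑-+ (elements R) _ _)
        (cong (λ e → ∑ (elements R) (λ (r , c , s) → h r c) + e) (∑-+ (elements R) _ _)))

  #triples-equal : #triples P ≡ #triples Q
  #triples-equal = ℤₚ.+-injective (trans (sym (∑-1 (elements P)))
    (trans (balanced-rc (λ _ _ → 1ℤ)) (∑-1 (elements Q))))

  private
    count-edges : ∀ {M N} (b : Fin M → Fin N → Bool) →
      ∑ (elements P) (λ _ → 1ℤ) ≡ ∑ (allFin M) (λ i → ∑ (allFin N) (λ j → 1ℤ * [ b i j ])) →
      length (filterᵇ (λ (i , j) → b i j) (cartesianProduct (allFin M) (allFin N))) ≡ #triples P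
    count-edges {M} {N} b eq = ℤₚ.+-injective (begin
      ℤ.+ length (filterᵇ (λ (i , j) → b i j) (cartesianProduct (allFin M) (allFin N)))
        ≡⟨ length-filter (λ (i , j) → b i j) (cartesianProduct (allFin M) (allFin N)) ⟩
      ∑ (cartesianProduct (allFin M) (allFin N)) (λ (i , j) → [ b i j ])
        ≡⟨ ∑-cartesianProduct (allFin M) (allFin N) _ ⟩
      ∑ (allFin M) (λ i → ∑ (allFin N) (λ j → [ b i j ]))
        ≡⟨ ∑-cong (allFin M) (λ i → ∑-cong (allFin N) λ j → ℤₚ.*-identityˡ [ b i j ]) ⟨
      ∑ (allFin M) (λ i → ∑ (allFin N) (λ j → 1ℤ * [ b i j ]))
        ≡⟨ eq ⟨
      ∑ (elements P) (λ _ → 1ℤ)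
        ≡⟨ ∑-1 (elements P) ⟩
      ℤ.+ #triples P ∎)
      where open ≡-Reasoning

  -- A triple has one edge of each of the three kinds, and two triples of the same colour never
  -- share an edge.
  #edges≡ : #edges P Q ≡ #triples P ℕ.+ #triples P ℕ.+ #triples P
  #edges≡ = cong₂ ℕ._+_ (cong₂ ℕ._+_
    (count-edges (λ r c → any (λ s → P (r , c , s)) (allFin p)) (∑-rc (λ _ _ → 1ℤ)))
    (count-edges (λ r s → any (λ c → P (r , c , s)) (allFin n)) (∑-rs (λ _ _ → 1ℤ))))
    (count-edges (λ c s → any (λ r → P (r , c , s)) (allFin m)) (∑-cs (λ _ _ → 1ℤ)))

  #vertices≡ : #vertices P Q ℕ.+ #faces P Q ≡ #edges P Q ℕ.+ 2 → m ℕ.+ n ℕ.+ p ≡ 2 ℕ.+ #triples P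
  #vertices≡ euler = ℕₚ.+-cancelʳ-≡ (#triples P ℕ.+ #triples P) _ _ (begin
    m ℕ.+ n ℕ.+ p ℕ.+ (#triples P ℕ.+ #triples P)
      ≡⟨ cong (λ k → m ℕ.+ n ℕ.+ p ℕ.+ (#triples P ℕ.+ k)) #triples-equal ⟩
    #vertices P Q ℕ.+ #faces P Q
      ≡⟨ euler ⟩
    #edges P Q ℕ.+ 2
      ≡⟨ cong (ℕ._+ 2) #edges≡ ⟩
    #triples P ℕ.+ #triples P ℕ.+ #triples P ℕ.+ 2
      ≡⟨ arith (#triples P) ⟩
    2 ℕ.+ #triples P ℕ.+ (#triples P ℕ.+ #triples P) ∎)
    where
    open ≡-Reasoning
    arith : ∀ k → k ℕ.+ k ℕ.+ k ℕ.+ 2 ≡ 2 ℕ.+ k ℕ.+ (k ℕ.+ k)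
    arith = ℕ-Solver.solve-∀

-- Propagation along mates by connectedness

module Connectivity {P Q : TripleSet m n p} (bitrade : IsLatinBitrade P Q)
  (connected : Connected P Q) where

  open Bitrade bitrade
  private module Q = Bitrade (swap-bitrade bitrade)

  -- A proper part of a bitrade closed under taking mates would be a smaller bitrade.
  mate-closed⇒all : (D : Triple m n p → Bool) →
    (∀ {t t′ α} → t ∈ P → t′ ∈ Q → t ~[ α ] t′ → D t ≡ D t′) →
    ∀ {t₀} → t₀ ∈ P → T (D t₀) → ∀ {t} → t ∈ P → T (D t)
  mate-closed⇒all D closed {t₀} t₀∈P D₀ {t₁} t₁∈P = decidable-stable (T? (D t₁)) λ ¬D₁ →
    connected (part P , part Q , smaller , part-⊊ t₁∈P ¬D₁ ,
      -- The row mate of the omitted triple is omitted as well, which makes the part of `Q` proper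
      -- too.
      (let t′ , t′∈Q , t′~t₁ , _ = mate t₁∈P rows
       in part-⊊ t′∈Q (subst (¬_ ∘ T) (closed t₁∈P t′∈Q (~-sym t′~t₁)) ¬D₁)))
    where
    part : TripleSet m n p → TripleSet m n p
    part R t = R t ∧ D t

    part⁺ : ∀ {R t} → t ∈ R → T (D t) → t ∈ part R
    part⁺ t∈R Dt = Equivalence.from T-∧ (t∈R , Dt)

    part⁻ : ∀ {R t} → t ∈ part R → t ∈ R × T (D t)
    part⁻ {R} {t} = Equivalence.to (T-∧ {R t})

    part-⊊ : ∀ {R t} → t ∈ R → ¬ T (D t) → part R ⊊ R
    part-⊊ {R} t∈R ¬Dt = proj₁ ∘ part⁻ {R} , λ R⊆ → ¬Dt (proj₂ (part⁻ {R} (R⊆ t∈R)))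

    part-pls : ∀ {R} → IsPartialLatinSquare R → IsPartialLatinSquare (part R)
    part-pls {R} pls t∈ t′∈ = pls (proj₁ (part⁻ {R} t∈)) (proj₁ (part⁻ {R} t′∈))

    part-mates : ∀ {R S} → HasUniqueMates R S →
      (∀ {t t′ α} → t ∈ R → t′ ∈ S → t ~[ α ] t′ → D t ≡ D t′) →
      HasUniqueMates (part R) (part S)
    part-mates {R} {S} mates closed {r} {c} {s} t∈
      with t∈R , Dt ← part⁻ {R} t∈
      with (r′ , (r′≢r , r∈S) , r! ) , (c′ , (c′≢c , c∈S) , c!) , (s′ , (s′≢s , s∈S) , s!) ← mates t∈R =
      (r′ , (r′≢r , keep {rows} r∈S
          λ { rows ne → contradiction refl ne ; columns _ → refl ; symbols _ → refl }) ,
        λ (ne , t′∈) → r! (ne , proj₁ (part⁻ {S} t′∈))) ,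
      (c′ , (c′≢c , keep {columns} c∈S
          λ { columns ne → contradiction refl ne ; rows _ → refl ; symbols _ → refl }) ,
        λ (ne , t′∈) → c! (ne , proj₁ (part⁻ {S} t′∈))) ,
      (s′ , (s′≢s , keep {symbols} s∈S
          λ { symbols ne → contradiction refl ne ; rows _ → refl ; columns _ → refl }) ,
        λ (ne , t′∈) → s! (ne , proj₁ (part⁻ {S} t′∈)))
      where
      keep : ∀ {α t′} → t′ ∈ S → (r , c , s) ~[ α ] t′ → t′ ∈ part S
      keep t′∈S t~t′ = part⁺ {S} t′∈S
        (subst T (closed (proj₁ (part⁻ {R} t∈)) t′∈S t~t′) (proj₂ (part⁻ {R} t∈)))

    smaller : IsLatinBitrade (part P) (part Q)
    smaller = record
      { W-nonEmpty = t₀ , part⁺ {P} t₀∈P D₀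
      ; B-nonEmpty = let t′ , t′∈Q , t′~t₀ , _ = mate t₀∈P rows in
          t′ , part⁺ {Q} t′∈Q (subst T (closed t₀∈P t′∈Q (~-sym t′~t₀)) D₀)
      ; W-partialLatinSquare = part-pls {P} P-pls
      ; B-partialLatinSquare = part-pls {Q} Q-pls
      ; W-mates = part-mates {P} {Q} P-mates closed
      ; B-mates = part-mates {Q} {P} Q-mates λ t∈Q t′∈P t~t′ → sym (closed t′∈P t∈Q (~-sym t~t′))
      }
      where
      open IsLatinBitrade bitrade renaming
        ( W-partialLatinSquare to P-pls; B-partialLatinSquare to Q-pls
        ; W-mates to P-mates; B-mates to Q-mates)

-- The kernel of the sizes and dual vectors

same-size⇒same-value : ∀ (x : Vertex m n p → ℤ) {t t′} α → t ~[ α ] t′ → ⟪ x , t ⟫ ≡ ⟪ x , t′ ⟫ →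
                       x (t ! α) ≡ x (t′ ! α)
same-size⇒same-value x {t} {t′} rows t~t′ eq =
  ℤ+.∙-cancelʳ (x (t ! columns)) _ _ (ℤ+.∙-cancelʳ (x (t ! symbols)) _ _ (trans eq
    (sym (cong₂ (λ u v → x (t′ ! rows) + x u + x v) (t~t′ columns λ ()) (t~t′ symbols λ ())))))
same-size⇒same-value x {t} {t′} columns t~t′ eq =
  ℤ+.∙-cancelˡ (x (t ! rows)) _ _ (ℤ+.∙-cancelʳ (x (t ! symbols)) _ _ (trans eq
    (sym (cong₂ (λ u v → x u + x (t′ ! columns) + x v) (t~t′ rows λ ()) (t~t′ symbols λ ())))))
same-size⇒same-value x {t} {t′} symbols t~t′ eq =
  ℤ+.∙-cancelˡ (x (t ! rows) + x (t ! columns)) _ _ (trans eq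
    (sym (cong₂ (λ u v → x u + x v + x (t′ ! symbols)) (t~t′ rows λ ()) (t~t′ columns λ ()))))

spanned : ∀ {P : TripleSet m n p} → Spanning P → ∀ v → ∃₂ λ t α → t ∈ P × t ! α ≡ v
spanned spanning (row r)    = let c , s , t∈P = proj₁ spanning r in _ , rows , t∈P , refl
spanned spanning (column c) = let r , s , t∈P = proj₁ (proj₂ spanning) c in _ , columns , t∈P , refl
spanned spanning (symbol s) = let r , c , t∈P = proj₂ (proj₂ spanning) s in _ , symbols , t∈P , refl

square-nonneg : ∀ a → 0ℤ ≤ a * a
square-nonneg a@(ℤ.+ k)    = subst (0ℤ ≤_) (ℤₚ.pos-* k k) (ℤ.+≤+ ℕ.z≤n)
square-nonneg ℤ.-[1+ k ] = ℤ.+≤+ ℕ.z≤n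

square≡0 : ∀ {a} → a * a ≡ 0ℤ → a ≡ 0ℤ
square≡0 {a} a²≡0 with ℤₚ.i*j≡0⇒i≡0∨j≡0 a a²≡0
... | inj₁ a≡0 = a≡0
... | inj₂ a≡0 = a≡0

triple-form : Triple m n p → Fin (m ℕ.+ n ℕ.+ p) → ℤ
triple-form t i =
  1ℤ * (1ℤ * δ (ι (t ! rows)) i + 1ℤ * δ (ι (t ! columns)) i) + 1ℤ * δ (ι (t ! symbols)) i

dot-triple : ∀ (t : Triple m n p) x → dot (triple-form t) x ≡ ⟪ x ∘ ι , t ⟫
dot-triple {m} {n} {p} t x = begin
  dot (triple-form t) x
    ≡⟨ dot-linear 1ℤ 1ℤ (λ i → 1ℤ * a i + 1ℤ * b i) d x ⟩
  1ℤ * dot (λ i → 1ℤ * a i + 1ℤ * b i) x + 1ℤ * dot d x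
    ≡⟨ cong (λ e → 1ℤ * e + 1ℤ * dot d x) (dot-linear 1ℤ 1ℤ a b x) ⟩
  1ℤ * (1ℤ * dot a x + 1ℤ * dot b x) + 1ℤ * dot d x
    ≡⟨ simplify (dot a x) (dot b x) (dot d x) ⟩
  dot a x + dot b x + dot d x
    ≡⟨ cong₂ _+_ (cong₂ _+_ (dot-δ _ x) (dot-δ _ x)) (dot-δ _ x) ⟩
  ⟪ x ∘ ι , t ⟫ ∎
  where
  open ≡-Reasoning
  a b d : Fin (m ℕ.+ n ℕ.+ p) → ℤ
  a = δ (ι (t ! rows))
  b = δ (ι (t ! columns))
  d = δ (ι (t ! symbols))
  simplify : ∀ a b d → 1ℤ * (1ℤ * a + 1ℤ * b) + 1ℤ * d ≡ a + b + d
  simplify = solve-∀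

module Duals {P Q : TripleSet m n p} (bitrade : IsLatinBitrade P Q) (connected : Connected P Q)
  (spanning : Spanning P) (size : m ℕ.+ n ℕ.+ p ≡ 2 ℕ.+ #triples P) where

  open Connectivity bitrade connected

  module _ {x : Vertex m n p → ℤ} (x≡0 : ∀ {t} → t ∈ P → ⟪ x , t ⟫ ≡ 0ℤ) where

    -- By `balanced` with both functions equal to `x`, the sum of squared sizes over `Q` is the one
    -- over `P`, which is 0; hence each square is 0.
    kernels-agree : ∀ {t} → t ∈ Q → ⟪ x , t ⟫ ≡ 0ℤ
    kernels-agree t∈Q = square≡0
      (∑≡0⇒terms≡0 (elements Q) (λ {t} _ → square-nonneg ⟪ x , t ⟫)
        (trans (sym (balanced bitrade x x))
          (∑-zero (elements P) λ t∈P → cong (λ e → e * e) (x≡0 (∈-elements⁻ P t∈P))))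
        (∈-elements⁺ Q t∈Q))

    -- A step to a mate changes one vertex while both sizes are 0, so the value at the changed
    -- vertex is preserved; connectedness does the rest. A kernel element is thus given by one value
    -- per axis, the three values adding up to 0, which is why two of them determine it in
    -- `kernel-trivial`.
    kernel-constant : ∀ {t₀ t} → t₀ ∈ P → t ∈ P → ∀ α → x (t ! α) ≡ x (t₀ ! α)
    kernel-constant {t₀} t₀∈P t∈P α = toWitness (mate-closed⇒all
      (λ t → ⌊ x (t ! α) ℤₚ.≟ x (t₀ ! α) ⌋)
      (λ t∈P t′∈Q t~t′ → cong (λ e → ⌊ e ℤₚ.≟ x (t₀ ! α) ⌋) (invariant t∈P t′∈Q t~t′))
      t₀∈P (fromWitness refl) t∈P)
      where
      invariant : ∀ {t t′ β} → t ∈ P → t′ ∈ Q → t ~[ β ] t′ → x (t ! α) ≡ x (t′ ! α)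
      invariant {t} {t′} {β} t∈P t′∈Q t~t′ with α ≟ₐ β
      ... | no α≢β  = cong x (t~t′ α α≢β)
      ... | yes refl = same-size⇒same-value x α t~t′ (trans (x≡0 t∈P) (sym (kernels-agree t′∈Q)))

    kernel-trivial : ∀ {t₀} → t₀ ∈ P → x (t₀ ! rows) ≡ 0ℤ → x (t₀ ! columns) ≡ 0ℤ → ∀ v → x v ≡ 0ℤ
    kernel-trivial {t₀} t₀∈P r≡0 c≡0 v with t , α , t∈P , refl ← spanned spanning v =
      trans (kernel-constant t₀∈P t∈P α) (at₀ α)
      where
      at₀ : ∀ α → x (t₀ ! α) ≡ 0ℤ
      at₀ rows    = r≡0
      at₀ columns = c≡0
      at₀ symbols = trans (sym (ℤₚ.+-identityˡ _)) (trans
        (cong (_+ x (t₀ ! symbols)) (sym (cong₂ _+_ r≡0 c≡0))) (x≡0 t₀∈P))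

  -- Size 0 is imposed at all triples but `t₀`, together with value 0 at the row and the column of
  -- `t₀`. These are |P| + 1 equations in |P| + 2 unknowns, so a nonzero solution exists. If its
  -- size at `t₀` were 0 too, it would lie in the kernel with two vanishing values and be zero.
  dual-vector : ∀ {t₀} → t₀ ∈ P →
    ∃ λ y → ⟪ y , t₀ ⟫ ≢ 0ℤ × (∀ {t} → t ∈ P → t ≢ t₀ → ⟪ y , t ⟫ ≡ 0ℤ)
  dual-vector {t₀} t₀∈P = y , nonzero , vanishes
    where
    -- The row condition takes the slot of the size equation of `t₀`, so that the equations stay
    -- indexed by the elements of `P`.
    E : Triple m n p → Fin (m ℕ.+ n ℕ.+ p) → ℤ
    E t with t ≟ₜ t₀
    ... | yes _ = δ (ι (t₀ ! rows))
    ... | no  _ = triple-form t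

    E-row : ∀ x → dot (E t₀) x ≡ 0ℤ → x (ι (t₀ ! rows)) ≡ 0ℤ
    E-row x Ex≡0 with t₀ ≟ₜ t₀
    ... | yes _   = trans (sym (dot-δ _ x)) Ex≡0
    ... | no t≢t = contradiction refl t≢t

    E-triple : ∀ {t} x → t ≢ t₀ → dot (E t) x ≡ 0ℤ → ⟪ x ∘ ι , t ⟫ ≡ 0ℤ
    E-triple {t} x t≢t₀ Ex≡0 with t ≟ₜ t₀
    ... | yes t≡t₀ = contradiction t≡t₀ t≢t₀
    ... | no _     = trans (sym (dot-triple t x)) Ex≡0

    equations : Fin (suc (#triples P)) → Fin (m ℕ.+ n ℕ.+ p) → ℤ
    equations zero    = δ (ι (t₀ ! columns))
    equations (suc e) = E (lookup (elements P) e)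

    solution = homogeneous-solution
      (subst (suc (#triples P) ℕ.<_) (sym size) (ℕₚ.n<1+n _)) equations

    x = proj₁ solution
    i = proj₁ (proj₁ (proj₂ solution))
    y = x ∘ ι

    E≡0 : ∀ {t} → t ∈ P → dot (E t) x ≡ 0ℤ
    E≡0 t∈P = let t∈ = ∈-elements⁺ P t∈P in
      trans (cong (λ t → dot (E t) x) (lookup-index t∈)) (proj₂ (proj₂ solution) (suc (index t∈)))

    vanishes : ∀ {t} → t ∈ P → t ≢ t₀ → ⟪ y , t ⟫ ≡ 0ℤ
    vanishes t∈P t≢t₀ = E-triple x t≢t₀ (E≡0 t∈P)

    nonzero : ⟪ y , t₀ ⟫ ≢ 0ℤ
    nonzero y₀≡0 = let v , ιv≡i = ι-surjective {m} {n} {p} i in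
      proj₂ (proj₁ (proj₂ solution)) (trans (cong x (sym ιv≡i))
        (kernel-trivial {x = y} vanishes′ t₀∈P (E-row x (E≡0 t₀∈P))
          (trans (sym (dot-δ _ x)) (proj₂ (proj₂ solution) zero)) v))
      where
      vanishes′ : ∀ {t} → t ∈ P → ⟪ y , t ⟫ ≡ 0ℤ
      vanishes′ {t} t∈P with t ≟ₜ t₀
      ... | yes refl = y₀≡0
      ... | no t≢t₀  = vanishes t∈P t≢t₀

-- Presented abelian groups

module IntegerMultiples {c ℓ} (G : AbelianGroup c ℓ) where

  open AbelianGroup G renaming (refl to ≈-refl; sym to ≈-sym; trans to ≈-trans)
  open AbelianGroupProperties G
  open CommutativeSemigroupProperties (AbelianGroup.commutativeSemigroup G) using (interchange)
  open Mult commutativeMonoid using (×-homo-+; ×-congʳ) renaming (_×_ to _·_)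
  open import Relation.Binary.Reasoning.Setoid setoid

  infixr 8 _⊗_

  _⊗_ : ℤ → Carrier → Carrier
  (ℤ.+ k)    ⊗ x = k · x
  ℤ.-[1+ k ] ⊗ x = (suc k · x) ⁻¹

  ⊗-cong : ∀ a {x y} → x ≈ y → a ⊗ x ≈ a ⊗ y
  ⊗-cong (ℤ.+ k)    x≈y = ×-congʳ k x≈y
  ⊗-cong ℤ.-[1+ k ] x≈y = ⁻¹-cong (×-congʳ (suc k) x≈y)

  ⊖-⊗ : ∀ j k x → (j ⊖ k) ⊗ x ≈ j · x ∙ (k · x) ⁻¹
  ⊖-⊗ zero    zero    x = ≈-sym (≈-trans (identityˡ _) ε⁻¹≈ε)
  ⊖-⊗ zero    (suc k) x = ≈-sym (identityˡ _)
  ⊖-⊗ (suc j) zero    x = ≈-sym (≈-trans (∙-congˡ ε⁻¹≈ε) (identityʳ _))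
  ⊖-⊗ (suc j) (suc k) x = begin
    (suc j ⊖ suc k) ⊗ x                 ≡⟨ cong (_⊗ x) (ℤₚ.[1+m]⊖[1+n]≡m⊖n j k) ⟩
    (j ⊖ k) ⊗ x                         ≈⟨ ⊖-⊗ j k x ⟩
    j · x ∙ (k · x) ⁻¹                  ≈⟨ identityˡ _ ⟨
    ε ∙ (j · x ∙ (k · x) ⁻¹)            ≈⟨ ∙-congʳ (inverseʳ x) ⟨
    (x ∙ x ⁻¹) ∙ (j · x ∙ (k · x) ⁻¹)   ≈⟨ interchange x (x ⁻¹) (j · x) ((k · x) ⁻¹) ⟩
    (x ∙ j · x) ∙ (x ⁻¹ ∙ (k · x) ⁻¹)   ≈⟨ ∙-congˡ (⁻¹-∙-comm x (k · x)) ⟩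
    suc j · x ∙ (suc k · x) ⁻¹          ∎

  ⊗-+ : ∀ a b x → (a + b) ⊗ x ≈ a ⊗ x ∙ b ⊗ x
  ⊗-+ (ℤ.+ j)    (ℤ.+ k)    x = ×-homo-+ x j k
  ⊗-+ (ℤ.+ j)    ℤ.-[1+ k ] x = ⊖-⊗ j (suc k) x
  ⊗-+ ℤ.-[1+ j ] (ℤ.+ k)    x = ≈-trans (⊖-⊗ k (suc j) x) (comm _ _)
  ⊗-+ ℤ.-[1+ j ] ℤ.-[1+ k ] x = begin
    (suc (suc (j ℕ.+ k)) · x) ⁻¹        ≡⟨ cong (λ i → (suc i · x) ⁻¹) (ℕₚ.+-suc j k) ⟨
    ((suc j ℕ.+ suc k) · x) ⁻¹          ≈⟨ ⁻¹-cong (×-homo-+ x (suc j) (suc k)) ⟩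
    (suc j · x ∙ suc k · x) ⁻¹          ≈⟨ ⁻¹-∙-comm _ _ ⟨
    (suc j · x) ⁻¹ ∙ (suc k · x) ⁻¹     ∎

  ⊗-neg : ∀ a x → (- a) ⊗ x ≈ (a ⊗ x) ⁻¹
  ⊗-neg (ℤ.+ zero)    x = ≈-sym ε⁻¹≈ε
  ⊗-neg (ℤ.+ (suc k)) x = ≈-refl
  ⊗-neg ℤ.-[1+ k ]    x = ≈-sym (⁻¹-involutive _)

  ⊗-ε : ∀ a → a ⊗ ε ≈ ε
  ⊗-ε (ℤ.+ zero)      = ≈-refl
  ⊗-ε (ℤ.+ (suc k))   = ≈-trans (identityˡ _) (⊗-ε (ℤ.+ k))
  ⊗-ε ℤ.-[1+ zero ]   = ≈-trans (⁻¹-cong (identityˡ ε)) ε⁻¹≈ε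
  ⊗-ε ℤ.-[1+ suc k ]  = ≈-trans (⁻¹-cong (identityˡ _)) (⊗-ε ℤ.-[1+ k ])

  module _ {X : Set} where

    ∑ᴳ : List X → (X → Carrier) → Carrier
    ∑ᴳ []       f = ε
    ∑ᴳ (x ∷ xs) f = f x ∙ ∑ᴳ xs f

    ∑ᴳ-cong : ∀ xs {f g : X → Carrier} → (∀ x → f x ≈ g x) → ∑ᴳ xs f ≈ ∑ᴳ xs g
    ∑ᴳ-cong []       f≈g = ≈-refl
    ∑ᴳ-cong (x ∷ xs) f≈g = ∙-cong (f≈g x) (∑ᴳ-cong xs f≈g)

    ∑ᴳ-zero : ∀ xs {f : X → Carrier} → (∀ {x} → x ∈ₗ xs → f x ≈ ε) → ∑ᴳ xs f ≈ ε
    ∑ᴳ-zero []       f≈ε = ≈-refl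
    ∑ᴳ-zero (x ∷ xs) f≈ε =
      ≈-trans (∙-cong (f≈ε (here refl)) (∑ᴳ-zero xs (f≈ε ∘ there))) (identityˡ ε)

    ∑ᴳ-∙ : ∀ xs (f g : X → Carrier) → ∑ᴳ xs (λ x → f x ∙ g x) ≈ ∑ᴳ xs f ∙ ∑ᴳ xs g
    ∑ᴳ-∙ []       f g = ≈-sym (identityˡ ε)
    ∑ᴳ-∙ (x ∷ xs) f g = ≈-trans (∙-congˡ (∑ᴳ-∙ xs f g)) (interchange _ _ _ _)

    ∑ᴳ-⁻¹ : ∀ xs (f : X → Carrier) → ∑ᴳ xs (λ x → f x ⁻¹) ≈ ∑ᴳ xs f ⁻¹
    ∑ᴳ-⁻¹ []       f = ≈-sym ε⁻¹≈ε
    ∑ᴳ-⁻¹ (x ∷ xs) f = ≈-trans (∙-congˡ (∑ᴳ-⁻¹ xs f)) (⁻¹-∙-comm _ _)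

    ∑ᴳ-single : ∀ {xs} {f : X → Carrier} {a} → Unique xs → a ∈ₗ xs →
                (∀ {x} → x ≢ a → f x ≈ ε) → ∑ᴳ xs f ≈ f a
    ∑ᴳ-single {x ∷ xs} (x∉xs ∷ _) (here refl) f≈ε =
      ≈-trans (∙-congˡ (∑ᴳ-zero xs λ y∈xs → f≈ε λ { refl → All.lookup x∉xs y∈xs refl })) (identityʳ _)
    ∑ᴳ-single {x ∷ xs} (x∉xs ∷ xs!) (there a∈xs) f≈ε =
      ≈-trans (∙-cong (f≈ε (All.lookup x∉xs a∈xs)) (∑ᴳ-single xs! a∈xs f≈ε)) (identityˡ _)

module Evaluation {X I : Set} (rel : I → Presentation.Term {X} {I}) where

  open Presentation {X} {I} using (Term; gen; 0#; presentedGroup)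

  open AbelianGroup (presentedGroup rel) public
    using (_≈_; _∙_; ε; _⁻¹; ∙-cong; ⁻¹-cong; setoid)
    renaming (refl to ≈-refl; sym to ≈-sym; trans to ≈-trans)
  open IntegerMultiples (presentedGroup rel) public

  -- The homomorphism from the free abelian group on `X` to ℤ that extends `x`. The relations `rel`
  -- are ignored, so it is in general not constant on classes of `_≈_`.
  eval : (X → ℤ) → Term → ℤ
  eval x (gen v)              = x v
  eval x 0#                   = 0ℤ
  eval x (σ Presentation.+ τ) = eval x σ + eval x τ
  eval x (Presentation.- σ)   = - eval x σ

  eval-⊗ : ∀ x a τ → eval x (a ⊗ τ) ≡ a * eval x τ
  eval-⊗ x (ℤ.+ k)    τ = nonneg k
    where
    nonneg : ∀ k → eval x ((ℤ.+ k) ⊗ τ) ≡ ℤ.+ k * eval x τ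
    nonneg zero    = sym (ℤₚ.*-zeroˡ (eval x τ))
    nonneg (suc k) = trans (cong (eval x τ +_) (nonneg k)) (sym (ℤₚ.suc-* (ℤ.+ k) (eval x τ)))
  eval-⊗ x ℤ.-[1+ k ] τ =
    trans (cong -_ (eval-⊗ x (ℤ.+ (suc k)) τ)) (ℤₚ.neg-distribˡ-* (ℤ.+ suc k) (eval x τ))

  eval-∑ᴳ : ∀ {Y : Set} x (ys : List Y) (f : Y → Term) → eval x (∑ᴳ ys f) ≡ ∑ ys (eval x ∘ f)
  eval-∑ᴳ x []       f = refl
  eval-∑ᴳ x (y ∷ ys) f = cong (eval x (f y) +_) (eval-∑ᴳ x ys f)

  module FreeAbelian (_≟_ : DecidableEquality X) {vs : List X}
    (vs-unique : Unique vs) (vs-complete : ∀ v → v ∈ₗ vs) where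

    open import Relation.Binary.Reasoning.Setoid setoid

    coefficient : Term → X → ℤ
    coefficient τ v = eval (λ w → [ does (v ≟ w) ]) τ

    normalise : Term → Term
    normalise τ = ∑ᴳ vs λ v → coefficient τ v ⊗ gen v

    normalise-≈ : ∀ τ → normalise τ ≈ τ
    normalise-≈ (gen v) = begin
      normalise (gen v)
        ≈⟨ ∑ᴳ-single vs-unique (vs-complete v) (λ {w} w≢v → ≡⇒≈ w v (dec-false (w ≟ v) w≢v)) ⟩
      [ does (v ≟ v) ] ⊗ gen v
        ≡⟨ cong (λ b → [ b ] ⊗ gen v) (dec-true (v ≟ v) refl) ⟩
      gen v ∙ ε
        ≈⟨ AbelianGroup.identityʳ (presentedGroup rel) (gen v) ⟩
      gen v ∎
      where
      ≡⇒≈ : ∀ w v → does (w ≟ v) ≡ _ → [ does (w ≟ v) ] ⊗ gen w ≈ ε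
      ≡⇒≈ w v eq rewrite eq = ≈-refl
    normalise-≈ 0# = ∑ᴳ-zero vs λ _ → ≈-refl
    normalise-≈ (σ Presentation.+ τ) = begin
      ∑ᴳ vs (λ v → (coefficient σ v + coefficient τ v) ⊗ gen v)
        ≈⟨ ∑ᴳ-cong vs (λ v → ⊗-+ (coefficient σ v) (coefficient τ v) (gen v)) ⟩
      ∑ᴳ vs (λ v → coefficient σ v ⊗ gen v ∙ coefficient τ v ⊗ gen v)
        ≈⟨ ∑ᴳ-∙ vs _ _ ⟩
      normalise σ ∙ normalise τ
        ≈⟨ ∙-cong (normalise-≈ σ) (normalise-≈ τ) ⟩
      σ ∙ τ ∎
    normalise-≈ (Presentation.- τ) = begin
      ∑ᴳ vs (λ v → (- coefficient τ v) ⊗ gen v)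
        ≈⟨ ∑ᴳ-cong vs (λ v → ⊗-neg (coefficient τ v) (gen v)) ⟩
      ∑ᴳ vs (λ v → (coefficient τ v ⊗ gen v) ⁻¹)
        ≈⟨ ∑ᴳ-⁻¹ vs _ ⟩
      normalise τ ⁻¹
        ≈⟨ ⁻¹-cong (normalise-≈ τ) ⟩
      τ ⁻¹ ∎

    -- The group axioms alone bring a term to a normal form whose coefficients are its evaluations
    -- at indicator functions. Identities between terms can therefore be proved by integer
    -- arithmetic.
    eval-injective : ∀ {σ τ} → (∀ x → eval x σ ≡ eval x τ) → σ ≈ τ
    eval-injective {σ} {τ} eq = begin
      σ           ≈⟨ normalise-≈ σ ⟨
      normalise σ ≈⟨ ∑ᴳ-cong vs (λ v →
                      AbelianGroup.reflexive (presentedGroup rel) (cong (_⊗ gen v) (eq _))) ⟩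
      normalise τ ≈⟨ normalise-≈ τ ⟩
      τ           ∎

-- Equality in the group of a partial latin square as integer combinations of triples

vertices : ∀ m n p → List (Vertex m n p)
vertices m n p = List.map row (allFin m) ++ List.map column (allFin n) ++ List.map symbol (allFin p)

∈-vertices : ∀ (v : Vertex m n p) → v ∈ₗ vertices m n p
∈-vertices {m} {n} {p} (row i)    = ∈-++⁺ˡ (∈-map⁺ row (∈-allFin i))
∈-vertices {m} {n} {p} (column j) =
  ∈-++⁺ʳ (List.map row (allFin m)) (∈-++⁺ˡ (∈-map⁺ column (∈-allFin j)))
∈-vertices {m} {n} {p} (symbol k) =
  ∈-++⁺ʳ (List.map row (allFin m)) (∈-++⁺ʳ (List.map column (allFin n)) (∈-map⁺ symbol (∈-allFin k)))

vertices-unique : Unique (vertices m n p)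
vertices-unique {m} {n} {p} = Unique.++⁺
  (Unique.map⁺ row-injective (Unique.allFin⁺ m))
  (Unique.++⁺
    (Unique.map⁺ column-injective (Unique.allFin⁺ n))
    (Unique.map⁺ symbol-injective (Unique.allFin⁺ p))
    λ (v∈ , v∈′) → case-cs (∈-map⁻ column v∈) (∈-map⁻ symbol v∈′))
  λ (v∈ , v∈′) → case-r (∈-map⁻ row v∈) (∈-++⁻ (List.map column (allFin n)) v∈′)
  where
  case-cs : ∀ {v : Vertex m n p} → (∃ λ j → j ∈ₗ allFin n × v ≡ column j) →
            (∃ λ k → k ∈ₗ allFin p × v ≡ symbol k) → ⊥
  case-cs (_ , _ , refl) (_ , _ , ())
  case-r : ∀ {v : Vertex m n p} → (∃ λ i → i ∈ₗ allFin m × v ≡ row i) →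
           v ∈ₗ List.map column (allFin n) ⊎ v ∈ₗ List.map symbol (allFin p) → ⊥
  case-r (_ , _ , refl) (inj₁ v∈) with () ← proj₂ (proj₂ (∈-map⁻ column v∈))
  case-r (_ , _ , refl) (inj₂ v∈) with () ← proj₂ (proj₂ (∈-map⁻ symbol v∈))

∑-delta : ∀ (P : TripleSet m n p) {t₀} → t₀ ∈ P → (f : Triple m n p → ℤ) →
          ∑ (elements P) (λ t → [ does (t ≟ₜ t₀) ] * f t) ≡ f t₀
∑-delta P {t₀} t₀∈P f = trans
  (∑-single (elements-unique P) (∈-elements⁺ P t₀∈P) λ {t} _ t≢t₀ →
    trans (cong (λ b → [ b ] * f t) (dec-false (t ≟ₜ t₀) t≢t₀)) (ℤₚ.*-zeroˡ (f t)))
  (trans (cong (λ b → [ b ] * f t₀) (dec-true (t₀ ≟ₜ t₀) refl)) (ℤₚ.*-identityˡ (f t₀)))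

module CanonicalRelations (P : TripleSet m n p) where

  open Presentation {Vertex m n p} {Σ[ t ∈ Triple m n p ] t ∈ P} using (Term; gen; 0#)

  tripleTerm : Triple m n p → Term
  tripleTerm t = gen (t ! rows) Presentation.+ gen (t ! columns) Presentation.+ gen (t ! symbols)

  open Evaluation {I = Σ[ t ∈ Triple m n p ] t ∈ P} (λ (t , _) → tripleTerm t) public
  open FreeAbelian _≟ᵥ_ vertices-unique ∈-vertices public using (eval-injective)

  -- The evaluation at `x` of the element ∑ u_t t of the free abelian group on the vertices.
  combination : (Triple m n p → ℤ) → (Vertex m n p → ℤ) → ℤ
  combination u x = ∑ (elements P) (λ t → u t * ⟪ x , t ⟫)

  combination-0 : ∀ x → combination (λ _ → 0ℤ) x ≡ 0ℤ
  combination-0 x = ∑-zero (elements P) λ {t} _ → ℤₚ.*-zeroˡ ⟪ x , t ⟫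

  combination-+ : ∀ u v x → combination (λ t → u t + v t) x ≡ combination u x + combination v x
  combination-+ u v x = trans
    (∑-cong (elements P) λ t → ℤₚ.*-distribʳ-+ ⟪ x , t ⟫ (u t) (v t)) (∑-+ (elements P) _ _)

  combination-neg : ∀ u x → combination (λ t → - u t) x ≡ - combination u x
  combination-neg u x = trans
    (∑-cong (elements P) λ t → sym (ℤₚ.neg-distribˡ-* (u t) ⟪ x , t ⟫)) (∑-neg (elements P) _)

  abstract
    -- Induction on the derivation: group axioms change no evaluation, `relation` contributes a
    -- single triple, and the remaining rules add or negate the combinations found so far. One `u`
    -- serves all `x`.
    ≈⇒combination : ∀ {σ τ} → σ ≈ τ → ∃ λ u → ∀ x → eval x σ ≡ eval x τ + combination u x
    ≈⇒combination = go
      where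
      open Presentation using
        (relation; refl; sym; trans; +-cong; -‿cong; +-assoc; +-comm; identityˡ; inverseˡ)
      Difference : Term → Term → Set
      Difference σ τ = ∃ λ u → ∀ x → eval x σ ≡ eval x τ + combination u x
      none : ∀ σ τ → (∀ x → eval x σ ≡ eval x τ) → Difference σ τ
      none _ τ eq = (λ _ → 0ℤ) , λ x → ≡.trans (eq x)
        (≡.trans (≡.sym (ℤₚ.+-identityʳ _)) (cong (eval x τ +_) (≡.sym (combination-0 x))))

      reversed : ∀ {a} b {c d} → a ≡ b + c → d ≡ - c → b ≡ a + d
      reversed b {c} ≡.refl ≡.refl = lemma b c
        where
        lemma : ∀ b c → b ≡ b + c + - c
        lemma = solve-∀

      composed : ∀ {a b} c {d e f} → a ≡ b + d → b ≡ c + e → f ≡ d + e → a ≡ c + f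
      composed c {d} {e} ≡.refl ≡.refl ≡.refl = lemma c d e
        where
        lemma : ∀ c d e → c + e + d ≡ c + (d + e)
        lemma = solve-∀

      added : ∀ {a a′} b b′ {c c′ f} → a ≡ b + c → a′ ≡ b′ + c′ → f ≡ c + c′ → a + a′ ≡ b + b′ + f
      added b b′ {c} {c′} ≡.refl ≡.refl ≡.refl = +-interchange b c b′ c′

      negated : ∀ {a} b {c d} → a ≡ b + c → d ≡ - c → - a ≡ - b + d
      negated b {c} ≡.refl ≡.refl = ℤₚ.neg-distrib-+ b c

      go : ∀ {σ τ} → σ ≈ τ → Difference σ τ
      go (relation (t₀ , t₀∈P)) = (λ t → [ does (t ≟ₜ t₀) ]) , λ x →
        ≡.trans (≡.sym (∑-delta P t₀∈P ⟪ x ,_⟫)) (≡.sym (ℤₚ.+-identityˡ _))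
      go {σ} refl = none σ σ λ _ → ≡.refl
      go {σ} (sym eq) with u , h ← go eq =
        (λ t → - u t) , λ x → reversed (eval x σ) (h x) (combination-neg u x)
      go {τ = τ} (trans eq eq′) with u , h ← go eq | v , k ← go eq′ =
        (λ t → u t + v t) , λ x → composed (eval x τ) (h x) (k x) (combination-+ u v x)
      go (+-cong {x′ = σ} {y′ = τ} eq eq′) with u , h ← go eq | v , k ← go eq′ =
        (λ t → u t + v t) , λ x → added (eval x σ) (eval x τ) (h x) (k x) (combination-+ u v x)
      go (-‿cong {y = τ} eq) with u , h ← go eq =
        (λ t → - u t) , λ x → negated (eval x τ) (h x) (combination-neg u x)
      go {σ₁} {σ₂} (+-assoc σ τ υ) = none σ₁ σ₂ λ x → ℤₚ.+-assoc (eval x σ) (eval x τ) (eval x υ)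
      go {σ₁} {σ₂} (+-comm σ τ)    = none σ₁ σ₂ λ x → ℤₚ.+-comm (eval x σ) (eval x τ)
      go {σ₁} {σ₂} (identityˡ τ)   = none σ₁ σ₂ λ x → ℤₚ.+-identityˡ (eval x τ)
      go {σ₁} {σ₂} (inverseˡ τ)    = none σ₁ σ₂ λ x → ℤₚ.+-inverseˡ (eval x τ)

  combination⇒≈0 : ∀ {τ} u → (∀ x → eval x τ ≡ combination u x) → τ ≈ 0#
  combination⇒≈0 {τ} u eq = ≈-trans (eval-injective λ x → trans (eq x) (sym (eval-ρ x))) ρ≈0
    where
    ρ : Term
    ρ = ∑ᴳ (elements P) λ t → u t ⊗ tripleTerm t
    eval-ρ : ∀ x → eval x ρ ≡ combination u x
    eval-ρ x = trans (eval-∑ᴳ x (elements P) _)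
      (∑-cong (elements P) λ t → eval-⊗ x (u t) (tripleTerm t))
    ρ≈0 : ρ ≈ 0#
    ρ≈0 = ∑ᴳ-zero (elements P) λ {t} t∈ →
      ≈-trans (⊗-cong (u t) (Presentation.relation (t , ∈-elements⁻ P t∈))) (⊗-ε (u t))

∑-supported : ∀ (P : TripleSet m n p) {t₀} → t₀ ∈ P → (f : Triple m n p → ℤ) →
              (∀ {t} → t ∈ P → t ≢ t₀ → f t ≡ 0ℤ) → ∑ (elements P) f ≡ f t₀
∑-supported P t₀∈P f f≗0 = ∑-single (elements-unique P) (∈-elements⁺ P t₀∈P)
  λ t∈ t≢t₀ → f≗0 (∈-elements⁻ P t∈) t≢t₀

-- Coefficient vectors of the black triples

TwoTorsion : TripleSet m n p → Set
TwoTorsion W = ∀ τ → IsTorsion (𝒜 W) τ → AbelianGroup._≈_ (𝒜 W) (τ Presentation.+ τ) Presentation.0#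

module Coefficients {W B : TripleSet m n p} (spherical : IsSpherical W B)
  (two-torsion : TwoTorsion W) where

  open IsSpherical spherical
  open CanonicalRelations W
  private
    size : m ℕ.+ n ℕ.+ p ≡ 2 ℕ.+ #triples W
    size = #vertices≡ isLatinBitrade euler
    bitrade′ = swap-bitrade isLatinBitrade
    module DW = Duals isLatinBitrade connected W-spanning size
    module DB = Duals bitrade′ (swap-connected connected) B-spanning
      (trans size (cong (2 ℕ.+_) (#triples-equal isLatinBitrade)))

  multiple≈0⇒torsion : ∀ {a τ} → a ≢ 0ℤ → a ⊗ τ ≈ ε → IsTorsion (𝒜 W) τ
  multiple≈0⇒torsion {ℤ.+ zero}    a≢0 aτ≈0 = contradiction refl a≢0
  multiple≈0⇒torsion {ℤ.+ (suc k)} a≢0 aτ≈0 = k , aτ≈0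
  multiple≈0⇒torsion {ℤ.-[1+ k ]}  a≢0 aτ≈0 = k ,
    ≈-trans (≈-sym (⁻¹-involutive _)) (≈-trans (⁻¹-cong aτ≈0) ε⁻¹≈ε)
    where open AbelianGroupProperties (𝒜 W) using (⁻¹-involutive; ε⁻¹≈ε)

  module _ {b} (b∈B : b ∈ B) where

    private
      z = proj₁ (DB.dual-vector b∈B)
      μ = ⟪ z , b ⟫
      μ≢0 = proj₁ (proj₂ (DB.dual-vector b∈B))
      z≡0 = proj₂ (proj₂ (DB.dual-vector b∈B))

    -- `balanced` replaces the white sum by the black one, where the size of `z` vanishes at every
    -- triple except `b`.
    pairing-z : ∀ x → combination ⟪ z ,_⟫ x ≡ μ * ⟪ x , b ⟫
    pairing-z x = trans (balanced isLatinBitrade z x) (∑-supported B b∈B _ λ {t} t∈B t≢b →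
      cong (_* ⟪ x , t ⟫) (z≡0 t∈B t≢b))

    tripleTerm-torsion : IsTorsion (𝒜 W) (tripleTerm b)
    tripleTerm-torsion = multiple≈0⇒torsion μ≢0 (combination⇒≈0 ⟪ z ,_⟫ λ x →
      trans (eval-⊗ x μ (tripleTerm b)) (sym (pairing-z x)))

    double≈0 : tripleTerm b ∙ tripleTerm b ≈ ε
    double≈0 = two-torsion (tripleTerm b) tripleTerm-torsion

    abstract
      coefficients : Triple m n p → ℤ
      coefficients = proj₁ (≈⇒combination double≈0)

      combination-coefficients : ∀ x → combination coefficients x ≡ ⟪ x , b ⟫ + ⟪ x , b ⟫
      combination-coefficients x =
        trans (sym (ℤₚ.+-identityˡ _)) (sym (proj₂ (≈⇒combination double≈0) x))

    -- Both sides are coefficients in expressions of 2μb through the white triples. Evaluating at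
    -- the dual vector of the white triple `t` leaves only the coefficient at `t`, and its nonzero
    -- size there is cancelled.
    dual-coefficients : ∀ {t} → t ∈ W → ⟪ z , t ⟫ + ⟪ z , t ⟫ ≡ μ * coefficients t
    dual-coefficients {t} t∈W =
      ℤₚ.*-cancelʳ-≡ (⟪ z , t ⟫ + ⟪ z , t ⟫) (μ * coefficients t) ⟪ y , t ⟫ {{ℤ.≢-nonZero λ≢0}} (begin
        (⟪ z , t ⟫ + ⟪ z , t ⟫) * ⟪ y , t ⟫   ≡⟨ ℤₚ.*-distribʳ-+ ⟪ y , t ⟫ ⟪ z , t ⟫ ⟪ z , t ⟫ ⟩
        ⟪ z , t ⟫ * ⟪ y , t ⟫ + ⟪ z , t ⟫ * ⟪ y , t ⟫
          ≡⟨ cong (λ e → e + e) (trans (sym (only-t ⟪ z ,_⟫)) (pairing-z y)) ⟩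
        μ * ⟪ y , b ⟫ + μ * ⟪ y , b ⟫         ≡⟨ ℤₚ.*-distribˡ-+ μ ⟪ y , b ⟫ ⟪ y , b ⟫ ⟨
        μ * (⟪ y , b ⟫ + ⟪ y , b ⟫)           ≡⟨ cong (μ *_) (combination-coefficients y) ⟨
        μ * combination coefficients y        ≡⟨ cong (μ *_) (only-t coefficients) ⟩
        μ * (coefficients t * ⟪ y , t ⟫)      ≡⟨ ℤₚ.*-assoc μ (coefficients t) ⟪ y , t ⟫ ⟨
        μ * coefficients t * ⟪ y , t ⟫        ∎)
      where
      open ≡-Reasoning
      y = proj₁ (DW.dual-vector t∈W)
      λ≢0 = proj₁ (proj₂ (DW.dual-vector t∈W))
      y≡0 = proj₂ (proj₂ (DW.dual-vector t∈W))
      only-t : ∀ u → combination u y ≡ u t * ⟪ y , t ⟫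
      only-t u = ∑-supported W t∈W _ λ {t′} t′∈W t′≢t →
        trans (cong (u t′ *_) (y≡0 t′∈W t′≢t)) (ℤₚ.*-zeroʳ (u t′))

    private
      -- Multiplication by `μ` turns the first vector into twice the sizes of `z`, so the inner
      -- product becomes twice the combination of `u′` evaluated at `z`, that is, 4 times the size
      -- of `z` at `b′`. This is 4μ for `b′ = b` and 0 for another black triple.
      scaled-product : ∀ {b′} (u′ : Triple m n p → ℤ) →
        (∀ x → combination u′ x ≡ ⟪ x , b′ ⟫ + ⟪ x , b′ ⟫) →
        μ * ∑ (elements W) (λ t → coefficients t * u′ t) ≡
          (⟪ z , b′ ⟫ + ⟪ z , b′ ⟫) + (⟪ z , b′ ⟫ + ⟪ z , b′ ⟫)
      scaled-product {b′} u′ u′-eq = begin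
        μ * ∑ (elements W) (λ t → coefficients t * u′ t)
          ≡⟨ ∑-*ˡ (elements W) μ (λ t → coefficients t * u′ t) ⟨
        ∑ (elements W) (λ t → μ * (coefficients t * u′ t))
          ≡⟨ ∑-congᴸ (elements W) (λ {t} t∈ → trans (sym (ℤₚ.*-assoc μ (coefficients t) (u′ t)))
               (trans (cong (_* u′ t) (sym (dual-coefficients (∈-elements⁻ W t∈))))
                      (double ⟪ z , t ⟫ (u′ t)))) ⟩
        ∑ (elements W) (λ t → u′ t * ⟪ z , t ⟫ + u′ t * ⟪ z , t ⟫)
          ≡⟨ ∑-+ (elements W) (λ t → u′ t * ⟪ z , t ⟫) (λ t → u′ t * ⟪ z , t ⟫) ⟩
        combination u′ z + combination u′ z
          ≡⟨ cong (λ e → e + e) (u′-eq z) ⟩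
        (⟪ z , b′ ⟫ + ⟪ z , b′ ⟫) + (⟪ z , b′ ⟫ + ⟪ z , b′ ⟫) ∎
        where
        open ≡-Reasoning
        double : ∀ a e → (a + a) * e ≡ e * a + e * a
        double = solve-∀

      cancel-μ : ∀ {a c} → μ * a ≡ μ * c → a ≡ c
      cancel-μ = ℤₚ.*-cancelˡ-≡ μ _ _ {{ℤ.≢-nonZero μ≢0}}

    coefficients-norm : ∑ (elements W) (λ t → coefficients t * coefficients t) ≡ ℤ.+ 4
    coefficients-norm = cancel-μ (trans (scaled-product coefficients combination-coefficients)
      (quadruple μ))
      where
      quadruple : ∀ a → (a + a) + (a + a) ≡ a * ((1ℤ + 1ℤ) + (1ℤ + 1ℤ))
      quadruple = solve-∀

    orthogonal-to : ∀ {b′} → b′ ∈ B → b′ ≢ b → ∀ u′ →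
      (∀ x → combination u′ x ≡ ⟪ x , b′ ⟫ + ⟪ x , b′ ⟫) →
      ∑ (elements W) (λ t → coefficients t * u′ t) ≡ 0ℤ
    orthogonal-to b′∈B b′≢b u′ u′-eq = cancel-μ (trans (scaled-product u′ u′-eq)
      (trans (cong (λ e → (e + e) + (e + e)) (z≡0 b′∈B b′≢b)) (sym (ℤₚ.*-zeroʳ μ))))

  coefficients-orthogonal : ∀ {b b′} (b∈B : b ∈ B) (b′∈B : b′ ∈ B) → b′ ≢ b →
    ∑ (elements W) (λ t → coefficients b∈B t * coefficients b′∈B t) ≡ 0ℤ
  coefficients-orthogonal b∈B b′∈B b′≢b =
    orthogonal-to b∈B b′∈B b′≢b (coefficients b′∈B) (combination-coefficients b′∈B)

-- The position of a white triple relative to a black one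

axis-cases : ∀ {α β γ : Axis} → α ≢ β → β ≢ γ → α ≢ γ → ∀ δ → δ ≡ α ⊎ δ ≡ β ⊎ δ ≡ γ
axis-cases {rows}    {columns} {symbols} _ _ _ rows    = inj₁ refl
axis-cases {rows}    {columns} {symbols} _ _ _ columns = inj₂ (inj₁ refl)
axis-cases {rows}    {columns} {symbols} _ _ _ symbols = inj₂ (inj₂ refl)
axis-cases {rows}    {symbols} {columns} _ _ _ rows    = inj₁ refl
axis-cases {rows}    {symbols} {columns} _ _ _ symbols = inj₂ (inj₁ refl)
axis-cases {rows}    {symbols} {columns} _ _ _ columns = inj₂ (inj₂ refl)
axis-cases {columns} {rows}    {symbols} _ _ _ columns = inj₁ refl
axis-cases {columns} {rows}    {symbols} _ _ _ rows    = inj₂ (inj₁ refl)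
axis-cases {columns} {rows}    {symbols} _ _ _ symbols = inj₂ (inj₂ refl)
axis-cases {columns} {symbols} {rows}    _ _ _ columns = inj₁ refl
axis-cases {columns} {symbols} {rows}    _ _ _ symbols = inj₂ (inj₁ refl)
axis-cases {columns} {symbols} {rows}    _ _ _ rows    = inj₂ (inj₂ refl)
axis-cases {symbols} {rows}    {columns} _ _ _ symbols = inj₁ refl
axis-cases {symbols} {rows}    {columns} _ _ _ rows    = inj₂ (inj₁ refl)
axis-cases {symbols} {rows}    {columns} _ _ _ columns = inj₂ (inj₂ refl)
axis-cases {symbols} {columns} {rows}    _ _ _ symbols = inj₁ refl
axis-cases {symbols} {columns} {rows}    _ _ _ columns = inj₂ (inj₁ refl)
axis-cases {symbols} {columns} {rows}    _ _ _ rows    = inj₂ (inj₂ refl)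
axis-cases {rows}    {rows}    {_}       α≢β _ _ _ = contradiction refl α≢β
axis-cases {columns} {columns} {_}       α≢β _ _ _ = contradiction refl α≢β
axis-cases {symbols} {symbols} {_}       α≢β _ _ _ = contradiction refl α≢β
axis-cases {_}       {rows}    {rows}    _ β≢γ _ _ = contradiction refl β≢γ
axis-cases {_}       {columns} {columns} _ β≢γ _ _ = contradiction refl β≢γ
axis-cases {_}       {symbols} {symbols} _ β≢γ _ _ = contradiction refl β≢γ
axis-cases {rows}    {_}       {rows}    _ _ α≢γ _ = contradiction refl α≢γ
axis-cases {columns} {_}       {columns} _ _ α≢γ _ = contradiction refl α≢γ
axis-cases {symbols} {_}       {symbols} _ _ α≢γ _ = contradiction refl α≢γ

next : Axis → Axis
next rows    = columns
next columns = symbols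
next symbols = rows

next-distinct : ∀ α → α ≢ next α × next α ≢ next (next α) × α ≢ next (next α)
next-distinct rows    = (λ ()) , (λ ()) , λ ()
next-distinct columns = (λ ()) , (λ ()) , λ ()
next-distinct symbols = (λ ()) , (λ ()) , λ ()

indicator : Vertex m n p → Vertex m n p → ℤ
indicator v w = [ does (v ≟ᵥ w) ]

incidence : ∀ (t w : Triple m n p) α → ⟪ indicator (t ! α) , w ⟫ ≡ indicator (t ! α) (w ! α)
incidence t w rows    = trans (ℤₚ.+-identityʳ _) (ℤₚ.+-identityʳ _)
incidence t w columns = trans (ℤₚ.+-identityʳ _) (ℤₚ.+-identityˡ _)
incidence t w symbols = ℤₚ.+-identityˡ _

indicator-same : ∀ {v w : Vertex m n p} → v ≡ w → indicator v w ≡ 1ℤ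
indicator-same {v = v} {w} v≡w = cong [_] (dec-true (v ≟ᵥ w) v≡w)

indicator-other : ∀ {v w : Vertex m n p} → v ≢ w → indicator v w ≡ 0ℤ
indicator-other {v = v} {w} v≢w = cong [_] (dec-false (v ≟ᵥ w) v≢w)

-- Its size is 1 at every triple: it supplies the constant -1 in `agreement`, and evaluating at it
-- yields the plain sum of the coefficients.
on-rows : Vertex m n p → ℤ
on-rows (row _)    = 1ℤ
on-rows (column _) = 0ℤ
on-rows (symbol _) = 0ℤ

-- For white w let f be the number of vertices shared with b, minus one, which lies in
-- {-1, 0, 1}.  Then ∑ u f = 4 = ∑ u² over the white triples, and as u² - u f ≥ 0 for each
-- of them, u is 0 or f.
agreement : Triple m n p → Vertex m n p → ℤ
agreement t v = indicator (t ! rows) v + indicator (t ! columns) v + indicator (t ! symbols) v - on-rows v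

agreement-count : ∀ (t w : Triple m n p) → ⟪ agreement t , w ⟫ ≡
  indicator (t ! rows) (w ! rows) + indicator (t ! columns) (w ! columns)
    + indicator (t ! symbols) (w ! symbols) - 1ℤ
agreement-count t w = collect (indicator (t ! rows) (w ! rows)) _ _
  where
  collect : ∀ a b d → ((a + 0ℤ + 0ℤ - 1ℤ) + (0ℤ + b + 0ℤ - 0ℤ)) + (0ℤ + 0ℤ + d - 0ℤ) ≡ a + b + d - 1ℤ
  collect = solve-∀

data Position {m n p} (b w : Triple m n p) : ℤ → Set where
  beside   : ∀ α → w ~[ α ] b → Position b w 1ℤ
  touching : Position b w 0ℤ
  opposite : (∀ α → w ! α ≢ b ! α) → Position b w -1ℤ

position : ∀ (b w : Triple m n p) → w ≢ b → Position b w ⟪ agreement b , w ⟫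
position b@(r , c , s) w@(r′ , c′ , s′) w≢b =
  subst (Position b w) (sym (agreement-count b w)) (go (r ≟ᶠ r′) (c ≟ᶠ c′) (s ≟ᶠ s′))
  where
  go : (dʳ : Dec (r ≡ r′)) (dᶜ : Dec (c ≡ c′)) (dˢ : Dec (s ≡ s′)) →
       Position b w ([ does dʳ ] + [ does dᶜ ] + [ does dˢ ] - 1ℤ)
  go (yes refl) (yes refl) (yes refl) = contradiction refl w≢b
  go (no _) (yes refl) (yes refl) = beside rows
    λ { rows ne → contradiction refl ne ; columns _ → refl ; symbols _ → refl }
  go (yes refl) (no _) (yes refl) = beside columns
    λ { columns ne → contradiction refl ne ; rows _ → refl ; symbols _ → refl }
  go (yes refl) (yes refl) (no _) = beside symbols
    λ { symbols ne → contradiction refl ne ; rows _ → refl ; columns _ → refl }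
  go (yes _) (no _) (no _) = touching
  go (no _) (yes _) (no _) = touching
  go (no _) (no _) (yes _) = touching
  go (no r≢) (no c≢) (no s≢) = opposite λ
    { rows    → r≢ ∘ sym ∘ row-injective
    ; columns → c≢ ∘ sym ∘ column-injective
    ; symbols → s≢ ∘ sym ∘ symbol-injective
    }

-- The expression is u (u - f), a square or a product of two consecutive integers. This is where
-- integrality of the coefficients enters.
excess-nonneg : ∀ {b w : Triple m n p} {f} → Position b w f → ∀ u → 0ℤ ≤ u * u - u * f
excess-nonneg {f = f} pos u = subst (0ℤ ≤_) (factor u f) (nonneg pos u)
  where
  factor : ∀ u f → u * (u - f) ≡ u * u - u * f
  factor = solve-∀
  nonneg : ∀ {b w : Triple m n p} {f} → Position b w f → ∀ u → 0ℤ ≤ u * (u - f)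
  nonneg (opposite _) (ℤ.+ k)          = nonneg-product k (k ℕ.+ 1)
    where
    nonneg-product : ∀ j k → 0ℤ ≤ ℤ.+ j * ℤ.+ k
    nonneg-product j k = subst (0ℤ ≤_) (ℤₚ.pos-* j k) (ℤ.+≤+ ℕ.z≤n)
  nonneg (opposite _) ℤ.-[1+ zero ]    = ℤ.+≤+ ℕ.z≤n
  nonneg (opposite _) ℤ.-[1+ suc k ]   = ℤ.+≤+ ℕ.z≤n
  nonneg touching     u                = subst (λ e → 0ℤ ≤ u * e) (sym (ℤₚ.+-identityʳ u)) (square-nonneg u)
  nonneg (beside _ _) (ℤ.+ zero)       = ℤ.+≤+ ℕ.z≤n
  nonneg (beside _ _) (ℤ.+ (suc k))    = subst (0ℤ ≤_) (ℤₚ.pos-* (suc k) k) (ℤ.+≤+ ℕ.z≤n)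
  nonneg (beside _ _) ℤ.-[1+ k ]       = ℤ.+≤+ ℕ.z≤n

excess≡0 : ∀ u f → u * u - u * f ≡ 0ℤ → u ≡ 0ℤ ⊎ u ≡ f
excess≡0 u f eq with ℤₚ.i*j≡0⇒i≡0∨j≡0 u (trans (factor u f) eq)
  where
  factor : ∀ u f → u * (u - f) ≡ u * u - u * f
  factor = solve-∀
... | inj₁ u≡0   = inj₁ u≡0
... | inj₂ u-f≡0 = inj₂ (ℤₚ.i-j≡0⇒i≡j u f u-f≡0)

-- The shape of one coefficient vector and its interaction with neighbouring ones

module Stars {W B : TripleSet m n p} (spherical : IsSpherical W B)
  (two-torsion : TwoTorsion W) where

  open IsSpherical spherical using (isLatinBitrade)
  open Coefficients spherical two-torsion
  open CanonicalRelations W using (combination)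
  open Bitrade isLatinBitrade using (agree-twice; ~⇒≡)
  private
    module B = Bitrade (swap-bitrade isLatinBitrade)

  module Star {b} (b∈B : b ∈ B) where

    u : Triple m n p → ℤ
    u = coefficients b∈B

    mate : Axis → Triple m n p
    mate α = proj₁ (B.mate b∈B α)

    mate∈W : ∀ α → mate α ∈ W
    mate∈W α = proj₁ (proj₂ (B.mate b∈B α))

    mate~ : ∀ α → mate α ~[ α ] b
    mate~ α = proj₁ (proj₂ (proj₂ (B.mate b∈B α)))

    mate≢ : ∀ α → mate α ! α ≢ b ! α
    mate≢ α = proj₂ (proj₂ (proj₂ (B.mate b∈B α)))

    mate-unique : ∀ {w α} → w ∈ W → w ~[ α ] b → w ≡ mate α
    mate-unique {w} {α} w∈W w~b =
      ~⇒≡ w∈W (mate∈W α) {α} λ β β≢α → trans (w~b β β≢α) (sym (mate~ α β β≢α))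

    data Coefficient (w : Triple m n p) : Set where
      vanishing : u w ≡ 0ℤ → Coefficient w
      positive  : ∀ α → w ≡ mate α → u w ≡ 1ℤ → Coefficient w
      negative  : (∀ α → w ! α ≢ b ! α) → u w ≡ -1ℤ → Coefficient w

    private
      -- Three shared vertices minus one. Doubled, this is 4 and cancels the squared length in
      -- `excess-sum`.
      self-agreement : ⟪ agreement b , b ⟫ ≡ ℤ.+ 2
      self-agreement = trans (agreement-count b b)
        (cong (_- 1ℤ) (cong₂ _+_ (cong₂ _+_
          (indicator-same {v = b ! rows} refl) (indicator-same {v = b ! columns} refl))
          (indicator-same {v = b ! symbols} refl)))

      excess-sum : ∑ (elements W) (λ w → u w * u w - u w * ⟪ agreement b , w ⟫) ≡ 0ℤ
      excess-sum = begin
        ∑ (elements W) (λ w → u w * u w - u w * ⟪ agreement b , w ⟫)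
          ≡⟨ ∑-+ (elements W) _ _ ⟩
        ∑ (elements W) (λ w → u w * u w) + ∑ (elements W) (λ w → - (u w * ⟪ agreement b , w ⟫))
          ≡⟨ cong₂ _+_ (coefficients-norm b∈B) (∑-neg (elements W) _) ⟩
        ℤ.+ 4 - combination u (agreement b)
          ≡⟨ cong (λ e → ℤ.+ 4 - e) (combination-coefficients b∈B (agreement b)) ⟩
        ℤ.+ 4 - (⟪ agreement b , b ⟫ + ⟪ agreement b , b ⟫)
          ≡⟨ cong (λ e → ℤ.+ 4 - (e + e)) self-agreement ⟩
        0ℤ ∎
        where open ≡-Reasoning

      position-W : ∀ {w} → w ∈ W → Position b w ⟪ agreement b , w ⟫
      position-W {w} w∈W = position b w λ { refl → disjoint isLatinBitrade w∈W b∈B }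

    coefficient : ∀ {w} → w ∈ W → Coefficient w
    coefficient {w} w∈W = classify (position-W w∈W) (excess≡0 (u w) ⟪ agreement b , w ⟫
      (∑≡0⇒terms≡0 (elements W) (λ {t} t∈ → excess-nonneg (position-W (∈-elements⁻ W t∈)) (u t))
        excess-sum (∈-elements⁺ W w∈W)))
      where
      classify : ∀ {f} → Position b w f → u w ≡ 0ℤ ⊎ u w ≡ f → Coefficient w
      classify _              (inj₁ u≡0) = vanishing u≡0
      classify (beside α w~b) (inj₂ u≡f) = positive α (mate-unique w∈W w~b) u≡f
      classify touching       (inj₂ u≡f) = vanishing u≡f
      classify (opposite w≢b) (inj₂ u≡f) = negative w≢b u≡f

    vertex-sum : ∀ (t : Triple m n p) β → ∑ (elements W) (λ w → u w * indicator (t ! β) (w ! β)) ≡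
      indicator (t ! β) (b ! β) + indicator (t ! β) (b ! β)
    vertex-sum t β = trans (∑-cong (elements W) λ w → cong (u w *_) (sym (incidence t w β)))
      (trans (combination-coefficients b∈B (indicator (t ! β))) (cong (λ e → e + e) (incidence t b β)))

    -- Of the white triangles at the vertex b ! β with a nonzero coefficient, only
    -- mate α and mate γ are left, and each contributes at most 1 to the sum 2.
    u-mate : ∀ α → u (mate α) ≡ 1ℤ
    u-mate α = conclude (coefficient (mate∈W α))
      where
      β = next α
      γ = next β
      α≢β = proj₁ (next-distinct α)
      β≢γ = proj₁ (proj₂ (next-distinct α))
      α≢γ = proj₂ (proj₂ (next-distinct α))

      times-0 : ∀ {w i} → i ≡ 0ℤ → u w * i ≡ 0ℤ
      times-0 {w} refl = ℤₚ.*-zeroʳ (u w)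

      only-γ : u (mate α) ≡ 0ℤ → ∀ {w} → Coefficient w → w ≢ mate γ →
               u w * indicator (b ! β) (w ! β) ≡ 0ℤ
      only-γ _ {w} (vanishing u≡0)  _ = trans (cong (_* indicator (b ! β) (w ! β)) u≡0)
        (ℤₚ.*-zeroˡ (indicator (b ! β) (w ! β)))
      only-γ _ {w} (negative w≢b _) _ = times-0 {w} (indicator-other (w≢b β ∘ sym))
      only-γ u≡0 {w} (positive δ w≡mate u≡1) w≢γ = by-axis (axis-cases α≢β β≢γ α≢γ δ)
        where
        by-axis : δ ≡ α ⊎ δ ≡ β ⊎ δ ≡ γ → u w * indicator (b ! β) (w ! β) ≡ 0ℤ
        by-axis (inj₁ δ≡α)        =
          contradiction (trans (sym u≡1) (trans (cong u (trans w≡mate (cong mate δ≡α))) u≡0)) λ ()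
        by-axis (inj₂ (inj₁ δ≡β)) = times-0 {w} (indicator-other λ b≡w →
          mate≢ β (trans (cong (λ t → t ! β) (sym (trans w≡mate (cong mate δ≡β)))) (sym b≡w)))
        by-axis (inj₂ (inj₂ δ≡γ)) = contradiction (trans w≡mate (cong mate δ≡γ)) w≢γ

      sum≡2 : u (mate α) ≡ 0ℤ → u (mate γ) * 1ℤ ≡ ℤ.+ 2
      sum≡2 u≡0 = trans (cong (u (mate γ) *_) (sym (indicator-same (sym (mate~ γ β β≢γ)))))
        (trans (sym (∑-supported W (mate∈W γ) _ λ w∈W → only-γ u≡0 (coefficient w∈W)))
          (trans (vertex-sum b β) (cong (λ e → e + e) (indicator-same {v = b ! β} refl))))

      small : Coefficient (mate γ) → u (mate γ) * 1ℤ ≢ ℤ.+ 2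
      small (vanishing u≡0)  eq = contradiction (trans (sym (cong (_* 1ℤ) u≡0)) eq) λ ()
      small (positive _ _ u≡1) eq = contradiction (trans (sym (cong (_* 1ℤ) u≡1)) eq) λ ()
      small (negative _ u≡-1) eq = contradiction (trans (sym (cong (_* 1ℤ) u≡-1)) eq) λ ()

      conclude : Coefficient (mate α) → u (mate α) ≡ 1ℤ
      conclude (positive _ _ u≡1)    = u≡1
      conclude (negative mate≢b _)   = contradiction (mate~ α β (α≢β ∘ sym)) (mate≢b β)
      conclude (vanishing u≡0)       = contradiction (sum≡2 u≡0) (small (coefficient (mate∈W γ)))

    private
      u-sum : ∑ (elements W) u ≡ ℤ.+ 2
      u-sum = trans (∑-cong (elements W) λ w → sym (ℤₚ.*-identityʳ (u w)))
        (combination-coefficients b∈B on-rows)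

      spread : ∑ (elements W) (λ w → u w * u w - u w) ≡ ℤ.+ 2
      spread = trans (∑-+ (elements W) _ _)
        (cong₂ _+_ (coefficients-norm b∈B) (trans (∑-neg (elements W) u) (cong -_ u-sum)))

      spread-nonneg : ∀ {w} → w ∈ₗ elements W → 0ℤ ≤ u w * u w - u w
      spread-nonneg {w} w∈ = by-coefficient (coefficient (∈-elements⁻ W w∈))
        where
        by-coefficient : Coefficient w → 0ℤ ≤ u w * u w - u w
        by-coefficient (vanishing u≡0)    = subst (λ e → 0ℤ ≤ e * e - e) (sym u≡0) (ℤ.+≤+ ℕ.z≤n)
        by-coefficient (positive _ _ u≡1) = subst (λ e → 0ℤ ≤ e * e - e) (sym u≡1) (ℤ.+≤+ ℕ.z≤n)
        by-coefficient (negative _ u≡-1)  = subst (λ e → 0ℤ ≤ e * e - e) (sym u≡-1) (ℤ.+≤+ ℕ.z≤n)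

    -- Each coefficient -1 contributes 2 to ∑ (u² - u) = 2.
    negative-unique : ∀ {w w′} → w ∈ W → w′ ∈ W → u w ≡ -1ℤ → u w′ ≡ -1ℤ → w ≡ w′
    negative-unique {w} {w′} w∈W w′∈W u≡-1 u′≡-1 = decidable-stable (w ≟ₜ w′) λ w≢w′ →
      contradiction
        (subst (ℤ._≤ ℤ.+ 2) (cong₂ _+_ (cong (λ e → e * e - e) u≡-1) (cong (λ e → e * e - e) u′≡-1))
          (subst (u w * u w - u w + (u w′ * u w′ - u w′) ≤_) spread
            (two-terms≤∑ (elements W) spread-nonneg (∈-elements⁺ W w∈W) (∈-elements⁺ W w′∈W) w≢w′)))
        λ { (ℤ.+≤+ (ℕ.s≤s (ℕ.s≤s ()))) }

    private
      -- The new vertex of `mate α` does not occur in `b`, so the coefficients of the white triples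
      -- at this vertex sum to 0, and the coefficient 1 of `mate α` has to be cancelled there.
      balancing : ∀ α → ∃ λ w → w ∈ W × u w ≡ -1ℤ × w ! α ≡ mate α ! α
      balancing α =
        w , w∈W , conclude (coefficient w∈W) (mate α ! α ≟ᵥ w ! α) (proj₂ (proj₂ search))
        where
        search = negative-term (elements W)
          (λ w → u w * indicator (mate α ! α) (w ! α)) (∈-elements⁺ W (mate∈W α))
          (subst (0ℤ <_) (sym (cong₂ _*_ (u-mate α) (indicator-same {v = mate α ! α} refl))) (ℤ.+<+ ℕ.z<s))
          (ℤₚ.≤-reflexive (trans (vertex-sum (mate α) α)
            (cong (λ e → e + e) (indicator-other (mate≢ α)))))
        w = proj₁ search
        w∈W = ∈-elements⁻ W (proj₁ (proj₂ search))
        conclude : Coefficient w → (d : Dec (mate α ! α ≡ w ! α)) → u w * [ does d ] < 0ℤ →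
                   u w ≡ -1ℤ × w ! α ≡ mate α ! α
        conclude _ (no _) uw<0 = contradiction (subst (_< 0ℤ) (ℤₚ.*-zeroʳ (u w)) uw<0) (ℤₚ.<-irrefl refl)
        conclude (negative _ u≡-1) (yes eq) _ = u≡-1 , sym eq
        conclude (vanishing u≡0) (yes _) uw<0 =
          contradiction (subst (λ e → e * 1ℤ < 0ℤ) u≡0 uw<0) (ℤₚ.<-irrefl refl)
        conclude (positive _ _ u≡1) (yes _) uw<0 =
          contradiction (subst (λ e → e * 1ℤ < 0ℤ) u≡1 uw<0) λ { (ℤ.+<+ ()) }

    antipode : Triple m n p
    antipode = proj₁ (balancing rows)

    antipode∈W : antipode ∈ W
    antipode∈W = proj₁ (proj₂ (balancing rows))

    u-antipode : u antipode ≡ -1ℤ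
    u-antipode = proj₁ (proj₂ (proj₂ (balancing rows)))

    -- The triples balancing the three mates all have coefficient -1, so by `negative-unique` they
    -- are one triple, which then contains all three new vertices.
    antipode! : ∀ α → antipode ! α ≡ mate α ! α
    antipode! α = let w , w∈W , u≡-1 , eq = balancing α in
      trans (cong (_! α) (negative-unique antipode∈W w∈W u-antipode u≡-1)) eq

  open Star

  -- The coefficient vectors of b and b′ are orthogonal and both have the coefficient 1
  -- at mate b∈B α, so their product is negative at another white triangle.
  second-neighbour : ∀ {b b′ α β γ} (b∈B : b ∈ B) (b′∈B : b′ ∈ B) → α ≢ β → β ≢ γ → α ≢ γ →
    b′ ~[ γ ] mate b∈B α → b′ ! γ ≡ antipode b∈B ! γ
  second-neighbour {b} {b′} {α} {β} {γ} b∈B b′∈B α≢β β≢γ α≢γ b′~mate =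
    conclude (coefficient b∈B w∈W) (coefficient b′∈B w∈W) uw<0
    where
    mate≡ : mate b∈B α ≡ mate b′∈B γ
    mate≡ = mate-unique b′∈B (mate∈W b∈B α) (~-sym b′~mate)

    b′α : b′ ! α ≡ mate b∈B α ! α
    b′α = b′~mate α α≢γ

    b′β : b′ ! β ≡ b ! β
    b′β = trans (b′~mate β β≢γ) (mate~ b∈B α β (α≢β ∘ sym))

    b′≢b : b′ ≢ b
    b′≢b refl = mate≢ b∈B α (sym b′α)

    search = negative-term (elements W) (λ w → u b∈B w * u b′∈B w)
      (∈-elements⁺ W (mate∈W b∈B α))
      (subst (0ℤ <_) (sym (cong₂ _*_ (u-mate b∈B α) (trans (cong (u b′∈B) mate≡) (u-mate b′∈B γ))))
        (ℤ.+<+ ℕ.z<s))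
      (ℤₚ.≤-reflexive (coefficients-orthogonal b∈B b′∈B b′≢b))

    w = proj₁ search
    w∈W : w ∈ W
    w∈W = ∈-elements⁻ W (proj₁ (proj₂ search))
    uw<0 : u b∈B w * u b′∈B w < 0ℤ
    uw<0 = proj₂ (proj₂ search)

    product : ∀ {i j} → u b∈B w ≡ i → u b′∈B w ≡ j → i * j < 0ℤ
    product u≡i u′≡j = subst (_< 0ℤ) (cong₂ _*_ u≡i u′≡j) uw<0

    conclude : Coefficient b∈B w → Coefficient b′∈B w → u b∈B w * u b′∈B w < 0ℤ →
               b′ ! γ ≡ antipode b∈B ! γ
    conclude (vanishing u≡0) _ uw<0 =
      contradiction (subst (_< 0ℤ) (trans (cong (_* u b′∈B w) u≡0) (ℤₚ.*-zeroˡ (u b′∈B w))) uw<0)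
        (ℤₚ.<-irrefl refl)
    conclude _ (vanishing u′≡0) uw<0 =
      contradiction (subst (_< 0ℤ) (trans (cong (u b∈B w *_) u′≡0) (ℤₚ.*-zeroʳ (u b∈B w))) uw<0)
        (ℤₚ.<-irrefl refl)
    conclude (positive _ _ u≡1) (positive _ _ u′≡1) _ = contradiction (product u≡1 u′≡1) λ { (ℤ.+<+ ()) }
    conclude (negative _ u≡-1) (negative _ u′≡-1) _ = contradiction (product u≡-1 u′≡-1) λ { (ℤ.+<+ ()) }
    -- Here `w` is a mate of `b` and the antipode of `b′`. Unless δ is β it would contain the β
    -- vertex common to `b` and `b′`. For δ equal to β, the α mate of `b′` and the γ mate of `b`
    -- share two vertices and coincide; compare their γ vertices.
    conclude (positive δ w≡mate _) (negative w≢b′ u′≡-1) _ = by-axis (axis-cases α≢β β≢γ α≢γ δ)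
      where
      w≡antipode : w ≡ antipode b′∈B
      w≡antipode = negative-unique b′∈B w∈W (antipode∈W b′∈B) u′≡-1 (u-antipode b′∈B)

      off-axis : δ ≢ β → w ! β ≡ b′ ! β
      off-axis δ≢β = trans (cong (_! β) w≡mate) (trans (mate~ b∈B δ β (δ≢β ∘ sym)) (sym b′β))

      mates≡ : δ ≡ β → mate b′∈B α ≡ mate b∈B γ
      mates≡ δ≡β = agree-twice (mate∈W b′∈B α) (mate∈W b∈B γ) α≢β
        (begin
          mate b′∈B α ! α   ≡⟨ antipode! b′∈B α ⟨
          antipode b′∈B ! α ≡⟨ cong (_! α) w≡antipode ⟨
          w ! α             ≡⟨ cong (_! α) w≡mate ⟩
          mate b∈B δ ! α    ≡⟨ mate~ b∈B δ α (λ α≡δ → α≢β (trans α≡δ δ≡β)) ⟩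
          b ! α             ≡⟨ mate~ b∈B γ α α≢γ ⟨
          mate b∈B γ ! α    ∎)
        (trans (mate~ b′∈B α β (α≢β ∘ sym)) (trans b′β (sym (mate~ b∈B γ β β≢γ))))
        where open ≡-Reasoning

      by-axis : δ ≡ α ⊎ δ ≡ β ⊎ δ ≡ γ → b′ ! γ ≡ antipode b∈B ! γ
      by-axis (inj₁ δ≡α)        = contradiction (off-axis λ δ≡β → α≢β (trans (sym δ≡α) δ≡β)) (w≢b′ β)
      by-axis (inj₂ (inj₂ δ≡γ)) = contradiction (off-axis λ δ≡β → β≢γ (trans (sym δ≡β) δ≡γ)) (w≢b′ β)
      by-axis (inj₂ (inj₁ δ≡β)) =
        trans (sym (mate~ b′∈B α γ (α≢γ ∘ sym)))
          (trans (cong (_! γ) (mates≡ δ≡β)) (sym (antipode! b∈B γ)))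
    -- Here `w` is the antipode of `b` and a mate of `b′`. It keeps the γ vertex of `b′` unless δ is
    -- γ, and then it would keep the β vertex, which is also that of `b`.
    conclude (negative w≢b u≡-1) (positive δ w≡mate′ _) _ = by-axis (δ ≟ₐ γ)
      where
      by-axis : Dec (δ ≡ γ) → b′ ! γ ≡ antipode b∈B ! γ
      by-axis (no δ≢γ) = sym (trans
        (cong (_! γ) (negative-unique b∈B (antipode∈W b∈B) w∈W (u-antipode b∈B) u≡-1))
        (trans (cong (_! γ) w≡mate′) (mate~ b′∈B δ γ (δ≢γ ∘ sym))))
      by-axis (yes δ≡γ) = contradiction (trans (cong (_! β) w≡mate′)
        (trans (mate~ b′∈B δ β (λ β≡δ → β≢γ (trans β≡δ δ≡γ))) b′β)) (w≢b β)

!-injective : ∀ {t t′ : Triple m n p} → (∀ α → t ! α ≡ t′ ! α) → t ≡ t′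
!-injective eq = cong₂ _,_ (row-injective (eq rows))
  (cong₂ _,_ (column-injective (eq columns)) (symbol-injective (eq symbols)))

~-trans : ∀ {α} {t t′ t″ : Triple m n p} → t ~[ α ] t′ → t′ ~[ α ] t″ → t ~[ α ] t″
~-trans t~t′ t′~t″ β β≢α = trans (t~t′ β β≢α) (t′~t″ β β≢α)

-- The octahedron

-- A face of the octahedron chooses between two opposite vertices on each axis, so faces are the
-- corners of the dual cube. `flip` crosses an edge, and parity is the colour.
Corner : Set
Corner = Bool × Bool × Bool

corners : List Corner
corners = cartesianProduct bools (cartesianProduct bools bools)
  where
  bools : List Bool
  bools = false ∷ true ∷ []

∈-corners : ∀ e → e ∈ₗ corners
∈-corners (i , j , k) = ∈-cartesianProduct⁺ (∈-bools i) (∈-cartesianProduct⁺ (∈-bools j) (∈-bools k))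
  where
  ∈-bools : ∀ i → i ∈ₗ false ∷ true ∷ []
  ∈-bools false = here refl
  ∈-bools true  = there (here refl)

odd : Corner → Bool
odd (i , j , k) = i xor (j xor k)

flip : Axis → Corner → Corner
flip rows    (i , j , k) = not i , j , k
flip columns (i , j , k) = i , not j , k
flip symbols (i , j , k) = i , j , not k

odd-flip : ∀ α e → odd (flip α e) ≡ not (odd e)
odd-flip rows    (true  , false , false) = refl
odd-flip rows    (true  , false , true)  = refl
odd-flip rows    (true  , true  , false) = refl
odd-flip rows    (true  , true  , true)  = refl
odd-flip rows    (false , _     , _)     = refl
odd-flip columns (false , true  , false) = refl
odd-flip columns (false , true  , true)  = refl
odd-flip columns (true  , true  , false) = refl
odd-flip columns (true  , true  , true)  = refl
odd-flip columns (false , false , _)     = refl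
odd-flip columns (true  , false , true)  = refl
odd-flip columns (true  , false , false) = refl
odd-flip symbols (false , false , _)     = refl
odd-flip symbols (true  , true  , true)  = refl
odd-flip symbols (true  , true  , false) = refl
odd-flip symbols (false , true  , true)  = refl
odd-flip symbols (false , true  , false) = refl
odd-flip symbols (true  , false , true)  = refl
odd-flip symbols (true  , false , false) = refl

corner : Triple m n p → Triple m n p → Corner → Triple m n p
corner (r , c , s) (r′ , c′ , s′) (i , j , k) =
  (if i then r′ else r) , (if j then c′ else c) , (if k then s′ else s)

corner-flip : ∀ (b a : Triple m n p) α e → corner b a (flip α e) ~[ α ] corner b a e
corner-flip b a rows    e rows    ne = contradiction refl ne
corner-flip b a rows    e columns _  = refl
corner-flip b a rows    e symbols _  = refl
corner-flip b a columns e rows    _  = refl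
corner-flip b a columns e columns ne = contradiction refl ne
corner-flip b a columns e symbols _  = refl
corner-flip b a symbols e rows    _  = refl
corner-flip b a symbols e columns _  = refl
corner-flip b a symbols e symbols ne = contradiction refl ne

module Octahedron {W B : TripleSet m n p} (spherical : IsSpherical W B)
  (two-torsion : TwoTorsion W)
  {b : Triple m n p} (b∈B : b ∈ B) where

  open IsSpherical spherical using (isLatinBitrade; connected)
  open Stars spherical two-torsion
  open Star b∈B
  private
    module W = Bitrade isLatinBitrade
    module B = Bitrade (swap-bitrade isLatinBitrade)

  a : Triple m n p
  a = antipode

  vertex-corner : Corner → Triple m n p
  vertex-corner = corner b a

  private
    mate-corner : ∀ α e → (∀ β → β ≢ α → vertex-corner e ! β ≡ b ! β) →
      vertex-corner e ! α ≡ a ! α → vertex-corner e ∈ W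
    mate-corner α e off at = subst (_∈ W) (!-injective λ β → eq β (β ≟ₐ α)) (mate∈W α)
      where
      eq : ∀ β → Dec (β ≡ α) → mate α ! β ≡ vertex-corner e ! β
      eq _ (yes refl) = trans (sym (antipode! α)) (sym at)
      eq β (no β≢α)   = trans (mate~ α β β≢α) (sym (off β β≢α))

    -- The γ mate of `mate α` is black and has the required vertices on α and β by construction; on
    -- γ this is `second-neighbour`.
    second-corner : ∀ α β γ e → α ≢ β → β ≢ γ → α ≢ γ →
      vertex-corner e ! α ≡ a ! α → vertex-corner e ! β ≡ b ! β → vertex-corner e ! γ ≡ a ! γ →
      vertex-corner e ∈ B
    second-corner α β γ e α≢β β≢γ α≢γ atα atβ atγ =
      subst (_∈ B) (!-injective λ δ → eq δ (axis-cases α≢β β≢γ α≢γ δ)) b′∈B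
      where
      neighbour = W.mate (mate∈W α) γ
      b′ = proj₁ neighbour
      b′∈B = proj₁ (proj₂ neighbour)
      b′~mate = proj₁ (proj₂ (proj₂ neighbour))
      eq : ∀ δ → δ ≡ α ⊎ δ ≡ β ⊎ δ ≡ γ → b′ ! δ ≡ vertex-corner e ! δ
      eq _ (inj₁ refl)        = trans (b′~mate α α≢γ) (trans (sym (antipode! α)) (sym atα))
      eq _ (inj₂ (inj₁ refl)) = trans (b′~mate β β≢γ) (trans (mate~ α β (α≢β ∘ sym)) (sym atβ))
      eq _ (inj₂ (inj₂ refl)) =
        trans (second-neighbour b∈B b′∈B α≢β β≢γ α≢γ b′~mate) (sym atγ)

  coloured : ∀ e → vertex-corner e ∈ (if odd e then W else B)
  coloured (false , false , false) = b∈B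
  coloured (true  , true  , true)  = antipode∈W
  coloured e@(true  , false , false) = mate-corner rows e
    (λ { rows ne → contradiction refl ne ; columns _ → refl ; symbols _ → refl }) refl
  coloured e@(false , true  , false) = mate-corner columns e
    (λ { columns ne → contradiction refl ne ; rows _ → refl ; symbols _ → refl }) refl
  coloured e@(false , false , true)  = mate-corner symbols e
    (λ { symbols ne → contradiction refl ne ; rows _ → refl ; columns _ → refl }) refl
  -- In these three cases the middle axis is the one on which the vertex of `b` is kept.
  coloured e@(true  , true  , false) =
    second-corner rows symbols columns e (λ ()) (λ ()) (λ ()) refl refl refl
  coloured e@(true  , false , true)  =
    second-corner rows columns symbols e (λ ()) (λ ()) (λ ()) refl refl refl
  coloured e@(false , true  , true)  =
    second-corner columns rows symbols e (λ ()) (λ ()) (λ ()) refl refl refl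

  IsCorner : Triple m n p → Set
  IsCorner t = t ∈ₗ List.map vertex-corner corners

  isCorner? : ∀ t → Dec (IsCorner t)
  isCorner? t = Any.any? (t ≟ₜ_) (List.map vertex-corner corners)

  isCorner⁺ : ∀ {t} e → t ≡ vertex-corner e → IsCorner t
  isCorner⁺ e refl = ∈-map⁺ vertex-corner (∈-corners e)

  isCorner⁻ : ∀ {t} → IsCorner t → ∃ λ e → t ≡ vertex-corner e
  isCorner⁻ t∈ = let e , _ , eq = ∈-map⁻ vertex-corner t∈ in e , eq

  private
    colour : Bool → TripleSet m n p
    colour o = if o then W else B

    -- A white corner is odd, since even corners are black. Its flip along α is then a black triple
    -- agreeing with `b′` off α, so it is `b′`.
    W⇒B : ∀ {w b′ α} → w ∈ W → b′ ∈ B → w ~[ α ] b′ → IsCorner w → IsCorner b′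
    W⇒B {w} {b′} {α} w∈W b′∈B w~b′ isCorner =
      by-parity (isCorner⁻ isCorner)
      where
      by-parity : (∃ λ e → w ≡ vertex-corner e) → IsCorner b′
      by-parity (e , w≡e) = opposite-parity (odd e) refl
        where
        w~e : w ~[ α ] vertex-corner (flip α e)
        w~e = subst (_~[ α ] vertex-corner (flip α e)) (sym w≡e) (~-sym (corner-flip b a α e))
        opposite-parity : ∀ o → odd e ≡ o → IsCorner b′
        opposite-parity false parity = contradiction
          (subst (_∈ B) (sym w≡e) (subst (λ o → vertex-corner e ∈ colour o) parity (coloured e)))
          (disjoint isLatinBitrade w∈W)
        opposite-parity true parity = isCorner⁺ (flip α e) (B.~⇒≡ b′∈B
          (subst (λ o → vertex-corner (flip α e) ∈ colour o)
            (trans (odd-flip α e) (cong not parity)) (coloured (flip α e)))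
          {α} (~-trans (~-sym w~b′) w~e))

    B⇒W : ∀ {w b′ α} → w ∈ W → b′ ∈ B → w ~[ α ] b′ → IsCorner b′ → IsCorner w
    B⇒W {w} {b′} {α} w∈W b′∈B w~b′ isCorner =
      by-parity (isCorner⁻ isCorner)
      where
      by-parity : (∃ λ e → b′ ≡ vertex-corner e) → IsCorner w
      by-parity (e , b′≡e) = opposite-parity (odd e) refl
        where
        b′~e : b′ ~[ α ] vertex-corner (flip α e)
        b′~e = subst (_~[ α ] vertex-corner (flip α e)) (sym b′≡e) (~-sym (corner-flip b a α e))
        opposite-parity : ∀ o → odd e ≡ o → IsCorner w
        opposite-parity true parity = contradiction b′∈B (disjoint isLatinBitrade
          (subst (_∈ W) (sym b′≡e) (subst (λ o → vertex-corner e ∈ colour o) parity (coloured e))))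
        opposite-parity false parity = isCorner⁺ (flip α e) (W.~⇒≡ w∈W
          (subst (λ o → vertex-corner (flip α e) ∈ colour o)
            (trans (odd-flip α e) (cong not parity)) (coloured (flip α e)))
          {α} (~-trans w~b′ b′~e))

    isYes-⇔ : ∀ {A A′ : Set} (d : Dec A) (d′ : Dec A′) → (A → A′) → (A′ → A) → ⌊ d ⌋ ≡ ⌊ d′ ⌋
    isYes-⇔ (yes _) (yes _)  _ _ = refl
    isYes-⇔ (no _)  (no _)   _ _ = refl
    isYes-⇔ (yes x) (no ¬x′) f _ = contradiction (f x) ¬x′
    isYes-⇔ (no ¬x) (yes x′) _ g = contradiction (g x′) ¬x

  all-corners : ∀ {t} → t ∈ W → ∃ λ e → t ≡ vertex-corner e
  all-corners t∈W = isCorner⁻ (toWitness (mate-closed⇒all (λ t → ⌊ isCorner? t ⌋)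
    (λ w∈W b′∈B w~b′ → isYes-⇔ (isCorner? _) (isCorner? _) (W⇒B w∈W b′∈B w~b′) (B⇒W w∈W b′∈B w~b′))
    antipode∈W (fromWitness (isCorner⁺ (true , true , true) refl)) t∈W))
    where open Connectivity isLatinBitrade connected

  vertex-cases : ∀ v → (∃ λ α → v ≡ b ! α) ⊎ (∃ λ α → v ≡ a ! α)
  vertex-cases v = let t , α , t∈W , t!α≡v = spanned (IsSpherical.W-spanning spherical) v in
    locate t!α≡v (all-corners t∈W)
    where
    on-corner : ∀ α e → (∃ λ β → vertex-corner e ! α ≡ b ! β) ⊎ (∃ λ β → vertex-corner e ! α ≡ a ! β)
    on-corner rows    (false , _ , _) = inj₁ (rows , refl)
    on-corner rows    (true  , _ , _) = inj₂ (rows , refl)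
    on-corner columns (_ , false , _) = inj₁ (columns , refl)
    on-corner columns (_ , true  , _) = inj₂ (columns , refl)
    on-corner symbols (_ , _ , false) = inj₁ (symbols , refl)
    on-corner symbols (_ , _ , true)  = inj₂ (symbols , refl)

    locate : ∀ {t α} → t ! α ≡ v → (∃ λ e → t ≡ vertex-corner e) →
             (∃ λ β → v ≡ b ! β) ⊎ (∃ λ β → v ≡ a ! β)
    locate {α = α} refl (e , refl) = on-corner α e

-- The torsion of the group of the octahedron

module Torsion {W B : TripleSet m n p} (spherical : IsSpherical W B)
  (two-torsion : TwoTorsion W) {b : Triple m n p} (b∈B : b ∈ B) where

  open CanonicalRelations W
  open Presentation {Vertex m n p} {Σ[ t ∈ Triple m n p ] t ∈ W} using (Term; gen; 0#)
  open AbelianGroup (𝒜 W) using (∙-congˡ; ∙-congʳ; identityʳ; assoc)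
  open AbelianGroupProperties (𝒜 W) using (ε⁻¹≈ε; inverseˡ-unique)
  open Octahedron spherical two-torsion b∈B using (a; vertex-cases)
  open Stars spherical two-torsion
  open Star b∈B using (mate; mate∈W; mate~; antipode!)
  open Coefficients spherical two-torsion using (double≈0)

  d : Term
  d = tripleTerm b

  -- The row and the column of `b` are to generate the free part and `d` the torsion; the symbol of
  -- `b` is `d` minus the other two.
  standard : ℤ → ℤ → ℤ → Term
  standard i j k = i ⊗ gen (b ! rows) ∙ j ⊗ gen (b ! columns) ∙ k ⊗ d

  eval-standard : ∀ x i j k →
    eval x (standard i j k) ≡ i * x (b ! rows) + j * x (b ! columns) + k * ⟪ x , b ⟫
  eval-standard x i j k = cong₂ _+_
    (cong₂ _+_ (eval-⊗ x i (gen (b ! rows))) (eval-⊗ x j (gen (b ! columns)))) (eval-⊗ x k d)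

  Standard : Term → Set
  Standard τ = ∃ λ i → ∃ λ j → ∃ λ k → τ ≈ standard i j k

  is-standard : ∀ {σ τ} i j k → σ ≈ τ →
    (∀ x → eval x τ ≡ i * x (b ! rows) + j * x (b ! columns) + k * ⟪ x , b ⟫) → Standard σ
  is-standard i j k σ≈τ eq =
    i , j , k , ≈-trans σ≈τ (eval-injective λ x → trans (eq x) (sym (eval-standard x i j k)))

  ∙-standard : ∀ {σ τ} → Standard σ → Standard τ → Standard (σ ∙ τ)
  ∙-standard (i , j , k , σ≈) (i′ , j′ , k′ , τ≈)
    = is-standard (i + i′) (j + j′) (k + k′) (∙-cong σ≈ τ≈)
      λ x → trans (cong₂ _+_ (eval-standard x i j k) (eval-standard x i′ j′ k′))
        (collect i j k i′ j′ k′ (x (b ! rows)) (x (b ! columns)) ⟪ x , b ⟫)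
    where
    collect : ∀ i j k i′ j′ k′ r c e → (i * r + j * c + k * e) + (i′ * r + j′ * c + k′ * e) ≡
      (i + i′) * r + (j + j′) * c + (k + k′) * e
    collect = solve-∀

  ⁻¹-standard : ∀ {τ} → Standard τ → Standard (τ ⁻¹)
  ⁻¹-standard (i , j , k , τ≈)
    = is-standard (- i) (- j) (- k) (⁻¹-cong τ≈)
      λ x → trans (cong -_ (eval-standard x i j k))
        (collect i j k (x (b ! rows)) (x (b ! columns)) ⟪ x , b ⟫)
    where
    collect : ∀ i j k r c e → - (i * r + j * c + k * e) ≡ - i * r + - j * c + - k * e
    collect = solve-∀

  base-standard : ∀ α → Standard (gen (b ! α))
  base-standard rows = is-standard 1ℤ 0ℤ 0ℤ ≈-refl λ x →
    lemma (x (b ! rows)) (x (b ! columns)) (x (b ! symbols))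
    where
    lemma : ∀ r c s → r ≡ 1ℤ * r + 0ℤ * c + 0ℤ * (r + c + s)
    lemma = solve-∀
  base-standard columns = is-standard 0ℤ 1ℤ 0ℤ ≈-refl λ x →
    lemma (x (b ! rows)) (x (b ! columns)) (x (b ! symbols))
    where
    lemma : ∀ r c s → c ≡ 0ℤ * r + 1ℤ * c + 0ℤ * (r + c + s)
    lemma = solve-∀
  base-standard symbols = is-standard -1ℤ -1ℤ 1ℤ ≈-refl λ x →
    lemma (x (b ! rows)) (x (b ! columns)) (x (b ! symbols))
    where
    lemma : ∀ r c s → s ≡ -1ℤ * r + -1ℤ * c + 1ℤ * (r + c + s)
    lemma = solve-∀

  size-exchange : ∀ (x : Vertex m n p → ℤ) α → x (a ! α) + ⟪ x , b ⟫ ≡ x (b ! α) + ⟪ x , mate α ⟫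
  size-exchange x α = trans (cong (λ v → x v + ⟪ x , b ⟫) (antipode! α)) (exchange α (mate~ α))
    where
    exchange : ∀ {t} α → t ~[ α ] b → x (t ! α) + ⟪ x , b ⟫ ≡ x (b ! α) + ⟪ x , t ⟫
    exchange {t} rows t~b =
      trans (lemma (x (t ! rows)) (x (b ! rows)) (x (b ! columns)) (x (b ! symbols)))
        (sym (cong₂ (λ v w → x (b ! rows) + (x (t ! rows) + x v + x w))
          (t~b columns λ ()) (t~b symbols λ ())))
      where
      lemma : ∀ t r c s → t + (r + c + s) ≡ r + (t + c + s)
      lemma = solve-∀
    exchange {t} columns t~b =
      trans (lemma (x (t ! columns)) (x (b ! rows)) (x (b ! columns)) (x (b ! symbols)))
        (sym (cong₂ (λ v w → x (b ! columns) + (x v + x (t ! columns) + x w))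
          (t~b rows λ ()) (t~b symbols λ ())))
      where
      lemma : ∀ t r c s → t + (r + c + s) ≡ c + (r + t + s)
      lemma = solve-∀
    exchange {t} symbols t~b =
      trans (lemma (x (t ! symbols)) (x (b ! rows)) (x (b ! columns)) (x (b ! symbols)))
        (sym (cong₂ (λ v w → x (b ! symbols) + (x v + x w + x (t ! symbols)))
          (t~b rows λ ()) (t~b columns λ ())))
      where
      lemma : ∀ t r c s → t + (r + c + s) ≡ s + (r + c + t)
      lemma = solve-∀

  -- Exchanging the α vertices turns `b` into `mate α`, which is a relator; hence the two generators
  -- differ by `d`, whose sign is immaterial because its double vanishes.
  antipode-gen : ∀ α → gen (a ! α) ≈ gen (b ! α) ∙ d
  antipode-gen α = begin
    gen (a ! α)                             ≈⟨ identityʳ _ ⟨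
    gen (a ! α) ∙ ε                         ≈⟨ ∙-congˡ (double≈0 b∈B) ⟨
    gen (a ! α) ∙ (d ∙ d)                   ≈⟨ assoc _ _ _ ⟨
    (gen (a ! α) ∙ d) ∙ d                   ≈⟨ ∙-congʳ (eval-injective λ x → size-exchange x α) ⟩
    (gen (b ! α) ∙ tripleTerm (mate α)) ∙ d ≈⟨ ∙-congʳ (∙-congˡ (Presentation.relation (mate α , mate∈W α))) ⟩
    (gen (b ! α) ∙ ε) ∙ d                   ≈⟨ ∙-congʳ (identityʳ _) ⟩
    gen (b ! α) ∙ d                         ∎
    where open import Relation.Binary.Reasoning.Setoid setoid

  d-standard : Standard d
  d-standard = is-standard 0ℤ 0ℤ 1ℤ ≈-refl λ x → lemma (x (b ! rows)) (x (b ! columns)) ⟪ x , b ⟫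
    where
    lemma : ∀ r c e → e ≡ 0ℤ * r + 0ℤ * c + 1ℤ * e
    lemma = solve-∀

  all-standard : ∀ τ → Standard τ
  all-standard (gen v) = by-cases (vertex-cases v)
    where
    by-cases : (∃ λ α → v ≡ b ! α) ⊎ (∃ λ α → v ≡ a ! α) → Standard (gen v)
    by-cases (inj₁ (α , refl)) = base-standard α
    by-cases (inj₂ (α , refl)) = let i , j , k , eq = ∙-standard (base-standard α) d-standard in
      i , j , k , ≈-trans (antipode-gen α) eq
  all-standard 0# = is-standard 0ℤ 0ℤ 0ℤ ≈-refl λ x → refl
  all-standard (σ Presentation.+ τ) = ∙-standard (all-standard σ) (all-standard τ)
  all-standard (Presentation.- τ) = ⁻¹-standard (all-standard τ)

  -- Such an `x` respects the relations and induces a homomorphism from the group to ℤ, which is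
  -- torsion-free.
  eval-torsion : ∀ x → (∀ t → ⟪ x , t ⟫ ≡ 0ℤ) → ∀ {σ τ} → IsTorsion (𝒜 W) τ → τ ≈ σ → eval x σ ≡ 0ℤ
  eval-torsion x x≡0 {σ} {τ} (k , kτ≈0) τ≈σ = trans (sym (invariant τ≈σ)) (cancel
    (ℤₚ.i*j≡0⇒i≡0∨j≡0 (ℤ.+ suc k) (trans (sym (eval-⊗ x (ℤ.+ suc k) τ)) (invariant kτ≈0))))
    where
    invariant : ∀ {σ τ} → σ ≈ τ → eval x σ ≡ eval x τ
    invariant {σ} {τ} σ≈τ = let u , eq = ≈⇒combination σ≈τ in trans (eq x) (trans
      (cong (eval x τ +_) (∑-zero (elements W) λ {t} _ → trans (cong (u t *_) (x≡0 t)) (ℤₚ.*-zeroʳ (u t))))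
      (ℤₚ.+-identityʳ (eval x τ)))
    cancel : ℤ.+ suc k ≡ 0ℤ ⊎ eval x τ ≡ 0ℤ → eval x τ ≡ 0ℤ
    cancel (inj₂ eq) = eq

  -- Both have size 0 at every triple. Evaluated at a standard form, they read off the coefficients
  -- of the row and the column of `b`.
  row-degree column-degree : Vertex m n p → ℤ
  row-degree (row _)       = 1ℤ
  row-degree (column _)    = 0ℤ
  row-degree (symbol _)    = -1ℤ
  column-degree (row _)    = 0ℤ
  column-degree (column _) = 1ℤ
  column-degree (symbol _) = -1ℤ

  torsion-multiple : ∀ {τ} → IsTorsion (𝒜 W) τ → ∃ λ k → τ ≈ k ⊗ d
  torsion-multiple {τ} torsion = bounded (all-standard τ)
    where
    drop : ∀ r c e → 0ℤ * r + 0ℤ * c + e ≡ e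
    drop = solve-∀
    first : ∀ i j k → i ≡ i * 1ℤ + j * 0ℤ + k * 0ℤ
    first = solve-∀
    second : ∀ i j k → j ≡ i * 0ℤ + j * 1ℤ + k * 0ℤ
    second = solve-∀
    bounded : Standard τ → ∃ λ k → τ ≈ k ⊗ d
    bounded (i , j , k , τ≈) = k , ≈-trans τ≈ (eval-injective λ x →
      trans (eval-standard x i j k) (trans
        (cong₂ (λ i j → i * x (b ! rows) + j * x (b ! columns) + k * ⟪ x , b ⟫) i≡0 j≡0)
        (trans (drop (x (b ! rows)) (x (b ! columns)) (k * ⟪ x , b ⟫)) (sym (eval-⊗ x k d)))))
      where
      i≡0 : i ≡ 0ℤ
      i≡0 = trans (first i j k) (trans (sym (eval-standard row-degree i j k))
        (eval-torsion row-degree (λ _ → refl) torsion τ≈))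
      j≡0 : j ≡ 0ℤ
      j≡0 = trans (second i j k) (trans (sym (eval-standard column-degree i j k))
        (eval-torsion column-degree (λ _ → refl) torsion τ≈))

  private
    d⁻¹≈d : d ⁻¹ ≈ d
    d⁻¹≈d = ≈-sym (inverseˡ-unique d d (double≈0 b∈B))

    TwoValued : Term → Set
    TwoValued τ = τ ≈ ε ⊎ τ ≈ d

    d∙-two-valued : ∀ {τ} → TwoValued τ → TwoValued (d ∙ τ)
    d∙-two-valued (inj₁ τ≈0) = inj₂ (≈-trans (∙-congˡ τ≈0) (identityʳ d))
    d∙-two-valued (inj₂ τ≈d) = inj₁ (≈-trans (∙-congˡ τ≈d) (double≈0 b∈B))

    ⁻¹-two-valued : ∀ {τ} → TwoValued τ → TwoValued (τ ⁻¹)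
    ⁻¹-two-valued (inj₁ τ≈0) = inj₁ (≈-trans (⁻¹-cong τ≈0) ε⁻¹≈ε)
    ⁻¹-two-valued (inj₂ τ≈d) = inj₂ (≈-trans (⁻¹-cong τ≈d) d⁻¹≈d)

    multiple-two-valued : ∀ k → TwoValued (k ⊗ d)
    multiple-two-valued (ℤ.+ k)    = nonneg k
      where
      nonneg : ∀ k → TwoValued ((ℤ.+ k) ⊗ d)
      nonneg zero    = inj₁ ≈-refl
      nonneg (suc k) = d∙-two-valued (nonneg k)
    multiple-two-valued ℤ.-[1+ k ] = ⁻¹-two-valued (multiple-two-valued (ℤ.+ suc k))

  torsion-two-elements : ∀ {τ} → IsTorsion (𝒜 W) τ → τ ≈ ε ⊎ τ ≈ d
  torsion-two-elements {τ} torsion =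
    let k , τ≈kd = torsion-multiple torsion in transport τ≈kd (multiple-two-valued k)
    where
    transport : ∀ {σ} → τ ≈ σ → TwoValued σ → TwoValued τ
    transport τ≈σ (inj₁ σ≈0) = inj₁ (≈-trans τ≈σ σ≈0)
    transport τ≈σ (inj₂ σ≈d) = inj₂ (≈-trans τ≈σ σ≈d)

-- The contradiction for elementary abelian groups of rank at least two

module _ {k} (T : SphericalLatinBitrade) (iso : canonicalGroup T ≅ ℤ₂^ k) where

  open SphericalLatinBitrade T
  private
    module K = AbelianGroup (canonicalGroup T)
    φ = proj₁ iso
  open GroupMorphisms (AbelianGroup.rawGroup (canonicalGroup T)) (AbelianGroup.rawGroup (ℤ₂^ k))
  open IsGroupIsomorphism (proj₂ iso)

  two-torsion : TwoTorsion W
  two-torsion τ torsion = injective {t K.∙ t} {K.ε} λ i →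
    trans (∙-homo t t i) (trans (p+p≡0ℙ (φ t i)) (sym (ε-homo i)))
    where
    t : K.Carrier
    t = τ , torsion

  -- The indices `i` and `j` witness that `s` and `t` have nonzero images, so both are the only
  -- possible nonzero torsion element `d` and their images agree.
  torsion-two-valued : ∀ (s t : K.Carrier) i j → φ s i ≡ 1ℙ → φ t j ≡ 1ℙ → φ s i ≡ φ t i
  torsion-two-valued s t i j φs≡1 φt≡1 =
    ⟦⟧-cong {s} {t} (≈-trans (nonzero≈d s i φs≡1) (≈-sym (nonzero≈d t j φt≡1))) i
    where
    b = IsLatinBitrade.B-nonEmpty (IsSpherical.isLatinBitrade isSpherical)
    open Torsion isSpherical two-torsion (proj₂ b)
    open CanonicalRelations W using (_≈_; ε; ≈-trans; ≈-sym)
    nonzero≈d : ∀ (t : K.Carrier) i → φ t i ≡ 1ℙ → proj₁ t ≈ d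
    nonzero≈d t i φt≡1 = by-cases (torsion-two-elements (proj₂ t))
      where
      by-cases : proj₁ t ≈ ε ⊎ proj₁ t ≈ d → proj₁ t ≈ d
      by-cases (inj₂ t≈d) = t≈d
      by-cases (inj₁ t≈0) = contradiction
        (trans (sym φt≡1) (trans (⟦⟧-cong {t} {K.ε} t≈0 i) (ε-homo i))) λ ()

theorem1p4 : ∀ (k : ℕ) → 2 ℕ.≤ k → ¬ (Σ[ T ∈ SphericalLatinBitrade ] canonicalGroup T ≅ ℤ₂^ k)
theorem1p4 (suc (suc k)) (ℕ.s≤s (ℕ.s≤s _)) (T , iso) =
  contradiction (trans (sym (φs zero)) (trans
    (torsion-two-valued T iso s t zero (suc zero) (φs zero) (φt (suc zero))) (φt zero))) λ ()
  where
  open AbelianGroup (canonicalGroup T) using (Carrier) renaming (refl to ≈-refl)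
  open GroupMorphisms (AbelianGroup.rawGroup (canonicalGroup T)) (AbelianGroup.rawGroup (ℤ₂^ (suc (suc k))))
  open IsGroupIsomorphism (proj₂ iso)

  -- Two different nonzero vectors: `e₁` is nonzero because there is a second coordinate, which is
  -- where rank at least 2 enters.
  e₀ e₁ : Fin (suc (suc k)) → Parity
  e₀ zero    = 1ℙ
  e₀ (suc _) = 0ℙ
  e₁ zero    = 0ℙ
  e₁ (suc _) = 1ℙ

  s t : Carrier
  s = proj₁ (surjective e₀)
  t = proj₁ (surjective e₁)

  φs : ∀ i → proj₁ iso s i ≡ e₀ i
  φs = proj₂ (surjective e₀) {s} (≈-refl {s})

  φt : ∀ i → proj₁ iso t i ≡ e₁ i
  φt = proj₂ (surjective e₁) {t} (≈-refl {t})
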